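{- For every integer $n\ge 1$, as polynomials in $x,y,z$, $$ \sum_{T\in\mathcal{PT}_{\mathrm B}(n)} x^{\operatorname{urr}(T)-1}\, y^{\operatorname{top}_{0,1}(T)}\,z^{\operatorname{diag}(T)} = (1+z)^n\, (x+y)_{n-1}.$$
   Context: Rising factorial: $(x)_0=1$, $(x)_n=x(x+1)\cdots(x+n-1)$ for $n\ge1$. Shifted Ferrers diagrams: a Ferrers diagram $F$ of length $n$ (rows plus columns, empty rows and columns allowed) has its south-east border steps labeled $1,\dots,n$ from north-east to south-west; a row gets the label of its south step, a column the label of its west step. So $F$ amounts to a splitting of $\{1,\dots,n\}$ into row labels and column labels; rows go top to bottom in increasing label order, columns left to right in decreasing label order, and there is a cell in Row $r$, Column $c$ iff $r<c$. If $F$ has $k$ columns, the shifted Ferrers diagram $\overline F$ is obtained by adding $k$ left-justified rows of sizes $1,2,\dots,k$ (top to bottom) above $F$; its length is that of $F$. The rightmost cells of the added rows are the diagonal cells. The added row whose diagonal cell is in Column $j$ is labeled $-j$; thus Row $-j$ has a cell in Column $c$ iff $c\ge j$ ($c$ a column label), and rows are again ordered top to bottom by increasing label. Type B permutation tableaux: $\mathcal{PT}_{\mathrm B}(n)$ is the set of shifted Ferrers diagrams of length $n$ with a $0,1$-filling of the cells such that (1) each column has at least one $1$; (2) there is no $0$ having both a $1$ above it in the same column and a $1$ to the left of it in the same row; (3) if a diagonal cell contains $0$, there is no $1$ to the left of it in the same row. Statistics: a $0$ of $T\in\mathcal{PT}_{\mathrm B}(n)$ is restricted if it has a $1$ above it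 in the same column or it is in a diagonal cell. A row is unrestricted if it contains no restricted $0$. $\operatorname{urr}(T)$ is the number of unrestricted rows; $\operatorname{diag}(T)$ is the number of diagonal cells containing a $1$. Let Row $m$ be the topmost unrestricted row of $T$. Then $\operatorname{top}_{0,1}(T)$ is the number of $1$'s in Row $m$, not counting the $1$ in the diagonal cell if there is one, plus the number of rightmost restricted $0$'s (a restricted $0$ that is the rightmost restricted $0$ of its row) in Column $|m|$, if Column $|m|$ exists. -}

module Defs where

open import Level using (0ℓ)
open import Algebra.Bundles.Raw using (RawSemiring)
import Algebra.Definitions.RawSemiring as RawSemiringDefs
open import Data.Bool using (Bool; true; false; if_then_else_)
import Data.Bool.Properties as Bool
open import Data.Fin as Fin using (Fin; toℕ)
open import Data.Fin.Properties using (all?; any?)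
import Data.Fin.Properties as Fin
open import Data.Integer as ℤ using (ℤ; +_; -[1+_])
import Data.Integer.Properties as ℤ
open import Data.List using (List; []; _∷_; [_]; _++_; length; filter; map; foldr; allFin; cartesianProductWith)
open import Data.List.Membership.Propositional using (_∈_)
open import Data.List.Membership.Propositional.Properties
  using (∈-filter⁺; ∈-filter⁻; ∈-cartesianProductWith⁺)
open import Data.List.Relation.Unary.Any using (here; there)
open import Data.List.Relation.Unary.All using ([]; _∷_)
open import Data.List.Relation.Unary.AllPairs using ([]; _∷_)
open import Data.List.Relation.Unary.Unique.Propositional using (Unique)
import Data.List.Relation.Unary.Unique.Propositional.Properties as Unique
open import Data.Nat as ℕ using (ℕ; zero; suc)
open import Data.Product using (_×_; _,_; proj₂; ∃; ∃-syntax)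
open import Data.Sum using (_⊎_)
open import Data.Vec as Vec using (Vec; []; _∷_; lookup; replicate; zipWith)
import Data.Vec.Properties as Vec
open import Function using (_⇔_; mk⇔)
open import Relation.Binary using (DecidableEquality)
open import Relation.Binary.PropositionalEquality using (_≡_; refl)
open import Relation.Nullary using (¬_; Dec; yes; no; does; ¬?; _×-dec_; _⊎-dec_; _→-dec_)
open import Relation.Unary using (Pred; Decidable)

------------------------------------------------------------------------
-- The polynomial ring ℤ[x,y,z]

-- A polynomial is a finite formal sum of terms c·x^a y^b z^d, stored as
-- (c , a ∷ b ∷ d ∷ []).  Terms with equal exponents may repeat, so equality
-- is equality of all coefficients.

Exponents : Set
Exponents = Vec ℕ 3

Poly : Set
Poly = List (ℤ × Exponents)

coeff : Poly → Exponents → ℤ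
coeff []            e = + 0
coeff ((c , d) ∷ p) e =
  (if does (Vec.≡-dec ℕ._≟_ d e) then c else + 0) ℤ.+ coeff p e

polyRawSemiring : RawSemiring 0ℓ 0ℓ
polyRawSemiring = record
  { Carrier = Poly
  ; _≈_     = λ p q → ∀ e → coeff p e ≡ coeff q e
  ; _+_     = _++_
  ; _*_     = cartesianProductWith λ (c , d) (c′ , d′) → c ℤ.* c′ , zipWith ℕ._+_ d d′
  ; 0#      = []
  ; 1#      = [ + 1 , replicate 3 0 ]
  }

X Y Z : Poly
X = [ + 1 , 1 ∷ 0 ∷ 0 ∷ [] ]
Y = [ + 1 , 0 ∷ 1 ∷ 0 ∷ [] ]
Z = [ + 1 , 0 ∷ 0 ∷ 1 ∷ [] ]

module _ {c ℓ} (R : RawSemiring c ℓ) where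
  open RawSemiring R using (Carrier; _+_; _*_; 0#; 1#)
  open RawSemiringDefs R using () renaming (_×_ to _·_)

  risingFactorial : Carrier → ℕ → Carrier
  risingFactorial x zero    = 1#
  risingFactorial x (suc n) = risingFactorial x n * (x + n · 1#)

  sumOver : ∀ {a} {A : Set a} → List A → (A → Carrier) → Carrier
  sumOver as f = foldr _+_ 0# (map f as)

------------------------------------------------------------------------
-- Shifted Ferrers diagrams and their 0,1-fillings

data Step : Set where
  south west : Step

_≟ˢ_ : DecidableEquality Step
south ≟ˢ south = yes refl
south ≟ˢ west  = no λ ()
west  ≟ˢ south = no λ ()
west  ≟ˢ west  = yes refl

-- The border lists the steps from north-east to south-west, so i : Fin n
-- stands for the border label suc (toℕ i).
--
-- The shifted diagram has exactly n rows, one for each i : Fin n: if step i is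
-- south this is Row (suc (toℕ i)), and if step i is west, so that i is a
-- column, it is the added Row -(suc (toℕ i)).  Hence i names Row ±(suc (toℕ i))
-- when used as a row, and Column (suc (toℕ i)) when used as a column.
--
-- entries holds the filling at (row , column); positions that are not
-- cells are required to be false in IsPTB below.

record Tableau (n : ℕ) : Set where
  constructor tableau
  field
    border  : Vec Step n
    entries : Vec (Vec Bool n) n

count : ∀ {n p} {P : Pred (Fin n) p} → Decidable P → ℕ
count {n} P? = length (filter P? (allFin n))

module _ {n : ℕ} (T : Tableau n) where
  open Tableau T

  IsRow IsColumn : Fin n → Set
  IsRow    i = lookup border i ≡ south
  IsColumn i = lookup border i ≡ west

  rowLabel : Fin n → ℤ
  rowLabel i with lookup border i
  ... | south = + suc (toℕ i)
  ... | west  = -[1+ toℕ i ]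

  Cell : Fin n → Fin n → Set
  Cell i j = IsColumn j × ((IsRow i × i Fin.< j) ⊎ (IsColumn i × i Fin.≤ j))

  Diagonal : Fin n → Fin n → Set
  Diagonal i j = IsColumn i × i ≡ j

  infix 4 _AboveOf_ _LeftOf_

  _AboveOf_ : Fin n → Fin n → Set
  i AboveOf i′ = rowLabel i ℤ.< rowLabel i′

  -- Columns are ordered left to right by decreasing label.
  _LeftOf_ : Fin n → Fin n → Set
  j LeftOf j′ = j′ Fin.< j

  entry : Fin n → Fin n → Bool
  entry i j = lookup (lookup entries i) j

  One Zero : Fin n → Fin n → Set
  One  i j = Cell i j × entry i j ≡ true
  Zero i j = Cell i j × entry i j ≡ false

  OneAbove OneLeft : Fin n → Fin n → Set
  OneAbove i j = ∃[ i′ ] (i′ AboveOf i × One i′ j)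
  OneLeft  i j = ∃[ j′ ] (j′ LeftOf j × One i j′)

  record IsPTB : Set where
    constructor isPTB
    field
      supported      : ∀ i j → ¬ Cell i j → entry i j ≡ false
      columnHasOne   : ∀ j → IsColumn j → ∃[ i ] One i j
      noZeroCorner   : ∀ i j → Zero i j → ¬ (OneAbove i j × OneLeft i j)
      diagonalZero   : ∀ i j → Diagonal i j → Zero i j → ¬ OneLeft i j

  Restricted : Fin n → Fin n → Set
  Restricted i j = Zero i j × (OneAbove i j ⊎ Diagonal i j)

  RightmostRestricted : Fin n → Fin n → Set
  RightmostRestricted i j = Restricted i j × (∀ j′ → Restricted i j′ → ¬ (j LeftOf j′))

  Unrestricted : Fin n → Set
  Unrestricted i = ¬ (∃[ j ] Restricted i j)

  TopmostUnrestricted : Fin n → Set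
  TopmostUnrestricted m = Unrestricted m × (∀ i → Unrestricted i → ¬ (i AboveOf m))

  isRow? : Decidable IsRow
  isRow? i = lookup border i ≟ˢ south

  isColumn? : Decidable IsColumn
  isColumn? i = lookup border i ≟ˢ west

  cell? : ∀ i j → Dec (Cell i j)
  cell? i j = isColumn? j ×-dec
    ((isRow? i ×-dec i Fin.<? j) ⊎-dec (isColumn? i ×-dec i Fin.≤? j))

  diagonal? : ∀ i j → Dec (Diagonal i j)
  diagonal? i j = isColumn? i ×-dec i Fin.≟ j

  one? : ∀ i j → Dec (One i j)
  one? i j = cell? i j ×-dec entry i j Bool.≟ true

  zero? : ∀ i j → Dec (Zero i j)
  zero? i j = cell? i j ×-dec entry i j Bool.≟ false

  oneAbove? : ∀ i j → Dec (OneAbove i j)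
  oneAbove? i j = any? λ i′ → rowLabel i′ ℤ.<? rowLabel i ×-dec one? i′ j

  oneLeft? : ∀ i j → Dec (OneLeft i j)
  oneLeft? i j = any? λ j′ → j Fin.<? j′ ×-dec one? i j′

  isPTB? : Dec IsPTB
  isPTB? with
      all? (λ i → all? λ j → ¬? (cell? i j) →-dec entry i j Bool.≟ false)
    | all? (λ j → isColumn? j →-dec any? λ i → one? i j)
    | all? (λ i → all? λ j → zero? i j →-dec ¬? (oneAbove? i j ×-dec oneLeft? i j))
    | all? (λ i → all? λ j → diagonal? i j →-dec (zero? i j →-dec ¬? (oneLeft? i j)))
  ... | yes a | yes b | yes c | yes d = yes (isPTB a b c d)
  ... | no ¬a | _     | _     | _     = no λ t → ¬a (IsPTB.supported t)
  ... | yes _ | no ¬b | _     | _     = no λ t → ¬b (IsPTB.columnHasOne t)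
  ... | yes _ | yes _ | no ¬c | _     = no λ t → ¬c (IsPTB.noZeroCorner t)
  ... | yes _ | yes _ | yes _ | no ¬d = no λ t → ¬d (IsPTB.diagonalZero t)

  restricted? : ∀ i j → Dec (Restricted i j)
  restricted? i j = zero? i j ×-dec (oneAbove? i j ⊎-dec diagonal? i j)

  rightmostRestricted? : ∀ i j → Dec (RightmostRestricted i j)
  rightmostRestricted? i j =
    restricted? i j ×-dec all? λ j′ → restricted? i j′ →-dec ¬? (j′ Fin.<? j)

  unrestricted? : Decidable Unrestricted
  unrestricted? i = ¬? (any? (restricted? i))

  topmostUnrestricted? : Decidable TopmostUnrestricted
  topmostUnrestricted? m =
    unrestricted? m ×-dec
    all? λ i → unrestricted? i →-dec ¬? (rowLabel i ℤ.<? rowLabel m)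

  urr : ℕ
  urr = count unrestricted?

  diag : ℕ
  diag = count λ i → diagonal? i i ×-dec one? i i

  -- The second summand is taken in Column |m|, which is again index m; if step
  -- m is south there is no such column, it has no cells, and the count is 0.
  top₀₁At : Fin n → ℕ
  top₀₁At m = count (λ j → one? m j ×-dec ¬? (diagonal? m j))
        ℕ.+ count (λ i → rightmostRestricted? i m)

  -- Distinct rows have distinct labels, so there is at most one topmost
  -- unrestricted row.  The value 0 is a default for when no row is
  -- unrestricted, which does not happen for tableaux of positive length.
  top₀₁ : ℕ
  top₀₁ with any? topmostUnrestricted?
  ... | yes (m , _) = top₀₁At m
  ... | no  _       = 0

------------------------------------------------------------------------
-- The set of type B permutation tableaux of length n, as a list

allVecs : ∀ {a} {A : Set a} → List A → ∀ n → List (Vec A n)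
allVecs as zero    = [ [] ]
allVecs as (suc n) = cartesianProductWith _∷_ as (allVecs as n)

allTableaux : ∀ n → List (Tableau n)
allTableaux n = cartesianProductWith tableau
  (allVecs (south ∷ west ∷ []) n)
  (allVecs (allVecs (false ∷ true ∷ []) n) n)

PTB : ∀ n → List (Tableau n)
PTB n = filter isPTB? (allTableaux n)

-- PTB n lists exactly the tableaux satisfying IsPTB, each once.

allVecs-complete : ∀ {a} {A : Set a} {as : List A} → (∀ a → a ∈ as) →
                   ∀ {n} (v : Vec A n) → v ∈ allVecs as n
allVecs-complete all []      = here refl
allVecs-complete all (a ∷ v) =
  ∈-cartesianProductWith⁺ _∷_ (all a) (allVecs-complete all v)

allVecs-unique : ∀ {a} {A : Set a} {as : List A} → Unique as → ∀ n → Unique (allVecs as n)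
allVecs-unique u zero    = [] ∷ []
allVecs-unique u (suc n) =
  Unique.cartesianProductWith⁺ _∷_ Vec.∷-injective u (allVecs-unique u n)

∈-PTB : ∀ {n} {T : Tableau n} → T ∈ PTB n ⇔ IsPTB T
∈-PTB {n} {tableau b e} = mk⇔
  (λ m → proj₂ (∈-filter⁻ isPTB? {xs = allTableaux n} m))
  (∈-filter⁺ isPTB? (∈-cartesianProductWith⁺ tableau
    (allVecs-complete (λ { south → here refl ; west → there (here refl) }) b)
    (allVecs-complete (allVecs-complete
      (λ { false → here refl ; true → there (here refl) })) e)))

PTB-unique : ∀ n → Unique (PTB n)
PTB-unique n = Unique.filter⁺ isPTB? (Unique.cartesianProductWith⁺ tableau
  (λ { refl → refl , refl })
  (allVecs-unique (((λ ()) ∷ []) ∷ [] ∷ []) n)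
  (allVecs-unique (allVecs-unique (((λ ()) ∷ []) ∷ [] ∷ []) n) n))

{-# OPTIONS --safe #-}
module Submission where

-- Removing the last border step of a type B tableau of length n + 1 leaves one of
-- length n.  Conversely, let T have k unrestricted rows, top₀₁ T = t and d diagonal
-- ones.  A south step adds an unrestricted row.  A west step adds a leftmost column
-- whose ones lie in unrestricted rows of T, together with a topmost row consisting of
-- the diagonal cell alone.
--  * Diagonal 1: the new row becomes the topmost unrestricted one, each row with a 0
--    in the column becomes restricted, and that 0 counts for top₀₁.  The extensions
--    contribute z^(d+1) (x + y)^k.
--  * Diagonal 0: the column needs a one, only the zeros below its highest one are
--    restricted, and the topmost unrestricted row is kept, gaining a one or not.
--    Together with the south step the extensions contribute
--    (x + y) (1 + x)^(k-1) y^t z^d.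
-- Hence, for n ≥ 1, P (n+1) x y z = (x + y) P n (1 + x) y z + z (x + y) P n (x + y) 1 z
-- for the generating functions over an arbitrary commutative semiring, and the product formula
-- satisfies the same recurrence.

open import Defs
open import Level using (0ℓ)
open import Algebra.Bundles using (CommutativeSemigroup; CommutativeSemiring)
open import Algebra.Bundles.Raw using (RawSemiring)
open import Algebra.Structures using (IsCommutativeMonoid)
open import Algebra.Structures.Biased using (isCommutativeSemiringˡ; isCommutativeMonoidˡ)
open import Data.Bool using (Bool; true; false; if_then_else_)
import Data.Bool.Properties as Bool
open import Data.Empty using (⊥-elim)
open import Data.Fin as Fin using (Fin; toℕ; fromℕ; inject₁)
import Data.Fin.Properties as Fin
open import Data.Fin.Relation.Unary.Top using (view; ‵fromℕ; ‵inject₁)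
open import Data.Integer as ℤ using (ℤ; +_; -[1+_])
import Data.Integer.Properties as ℤ
open import Data.List as List
  using (List; []; _∷_; [_]; _++_; length; filter; tabulate; allFin; map; concatMap)
import Data.List.Properties as List
open import Data.List.Membership.Propositional using (_∈_; _∉_; find; lose)
open import Data.List.Membership.Propositional.Properties
open import Data.List.Membership.Propositional.Properties.WithK using (unique∧set⇒bag)
open import Data.List.Relation.Binary.BagAndSetEquality using (∼bag⇒↭)
open import Data.List.Relation.Binary.Disjoint.Propositional using (Disjoint)
open import Data.List.Relation.Binary.Permutation.Propositional as ↭ using (_↭_; ↭-sym; ↭⇒↭ₛ)
open import Data.List.Relation.Binary.Permutation.Propositional.Properties using (↭-length; ∈-resp-↭)
import Data.List.Relation.Binary.Permutation.Setoid.Properties as Permutationₛ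
open import Data.List.Relation.Unary.All as All using (All; []; _∷_)
import Data.List.Relation.Unary.All.Properties as All
open import Data.List.Relation.Unary.AllPairs as AllPairs using (AllPairs; []; _∷_)
import Data.List.Relation.Unary.AllPairs.Properties as AllPairs
open import Data.List.Relation.Unary.Any as Any using (Any; here; there)
import Data.List.Relation.Unary.Sorted.TotalOrder.Properties as Sorted
open import Data.List.Relation.Unary.Unique.Propositional using (Unique)
import Data.List.Relation.Unary.Unique.Propositional.Properties as Unique
open import Data.Nat as ℕ using (ℕ; zero; suc; _≤_; _∸_)
import Data.Nat.Properties as ℕ
open import Data.Product using (_×_; _,_; proj₁; proj₂; ∃-syntax; map₁; map₂)
open import Data.Sum as Sum using (_⊎_; inj₁; inj₂; [_,_]′)
open import Data.Vec as Vec using (Vec; []; _∷_; _∷ʳ_; lookup; replicate; initLast; zipWith; _[_]≔_)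
import Data.Vec.Properties as Vec
import Data.Vec.Relation.Unary.Any as VecAny
import Data.Vec.Relation.Unary.Any.Properties as VecAny
open import Function using (_⇔_; mk⇔; _∘_; id; Equivalence; case_of_)
open import Relation.Binary using (Rel; IsEquivalence; DecTotalOrder; tri<; tri≈; tri>)
import Relation.Binary.Construct.On as On
open import Relation.Binary.PropositionalEquality as ≡
  using (_≡_; _≢_; refl; sym; trans; cong; cong₂; subst; module ≡-Reasoning)
open import Relation.Nullary using (¬_; Dec; yes; no; does; ¬?; _×-dec_)
open import Relation.Unary using (Pred; Decidable)

open Equivalence using (to; from)

-- Polynomials up to equality of coefficients form a commutative semiring.

module PolynomialSemiring where

  module Pol = RawSemiring polyRawSemiring

  infixl 7 _·ₜ_
  infixl 6 _⊕_

  _⊕_ : ∀ {m} → Vec ℕ m → Vec ℕ m → Vec ℕ m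
  _⊕_ = zipWith ℕ._+_

  _·ₜ_ : ℤ × Exponents → ℤ × Exponents → ℤ × Exponents
  (c , d) ·ₜ (c′ , d′) = c ℤ.* c′ , d ⊕ d′

  ⊕-cancelˡ : ∀ {m} (d : Vec ℕ m) {f g} → d ⊕ f ≡ d ⊕ g → f ≡ g
  ⊕-cancelˡ []      {[]}    {[]}    eq = refl
  ⊕-cancelˡ (a ∷ d) {b ∷ f} {c ∷ g} eq =
    cong₂ _∷_ (ℕ.+-cancelˡ-≡ a b c (Vec.∷-injectiveˡ eq)) (⊕-cancelˡ d (Vec.∷-injectiveʳ eq))

  ⊕-divides? : ∀ {m} (d e : Vec ℕ m) → Dec (∃[ f ] d ⊕ f ≡ e)
  ⊕-divides? []      []      = yes ([] , refl)
  ⊕-divides? (a ∷ d) (b ∷ e) with a ℕ.≤? b | ⊕-divides? d e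
  ... | yes a≤b | yes (f , eq) = yes (b ℕ.∸ a ∷ f , cong₂ _∷_ (ℕ.m+[n∸m]≡n a≤b) eq)
  ... | no  a≰b | _            = no λ where
    (c ∷ _ , eq) → a≰b (subst (a ℕ.≤_) (Vec.∷-injectiveˡ eq) (ℕ.m≤m+n a c))
  ... | _       | no ∄f        = no λ where
    (_ ∷ f , eq) → ∄f (f , Vec.∷-injectiveʳ eq)

  coeff-++ : ∀ p q e → coeff (p ++ q) e ≡ coeff p e ℤ.+ coeff q e
  coeff-++ []            q e = sym (ℤ.+-identityˡ _)
  coeff-++ ((c , d) ∷ p) q e = trans (cong (ℤ._+_ a) (coeff-++ p q e)) (sym (ℤ.+-assoc a _ _))
    where a = if does (Vec.≡-dec ℕ._≟_ d e) then c else + 0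

  -- Adding `d` to exponents is injective, so a term of `q` lands on `d ⊕ f` exactly when its own
  -- exponent is `f`.
  coeff-scale : ∀ c d q f → coeff (map ((c , d) ·ₜ_) q) (d ⊕ f) ≡ c ℤ.* coeff q f
  coeff-scale c d []              f = sym (ℤ.*-zeroʳ c)
  coeff-scale c d ((c′ , d′) ∷ q) f = trans
    (cong₂ ℤ._+_ head (coeff-scale c d q f))
    (sym (ℤ.*-distribˡ-+ c (if does (Vec.≡-dec ℕ._≟_ d′ f) then c′ else + 0) (coeff q f)))
    where
    head : (if does (Vec.≡-dec ℕ._≟_ (d ⊕ d′) (d ⊕ f)) then c ℤ.* c′ else + 0)
         ≡ c ℤ.* (if does (Vec.≡-dec ℕ._≟_ d′ f) then c′ else + 0)
    head with Vec.≡-dec ℕ._≟_ (d ⊕ d′) (d ⊕ f) | Vec.≡-dec ℕ._≟_ d′ f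
    ... | yes _  | yes _  = refl
    ... | no  _  | no  _  = sym (ℤ.*-zeroʳ c)
    ... | yes eq | no neq = ⊥-elim (neq (⊕-cancelˡ d eq))
    ... | no neq | yes eq = ⊥-elim (neq (cong (d ⊕_) eq))

  coeff-scale-∤ : ∀ c d q e → ¬ (∃[ f ] d ⊕ f ≡ e) → coeff (map ((c , d) ·ₜ_) q) e ≡ + 0
  coeff-scale-∤ c d []              e ∄f = refl
  coeff-scale-∤ c d ((c′ , d′) ∷ q) e ∄f with Vec.≡-dec ℕ._≟_ (d ⊕ d′) e
  ... | yes eq = ⊥-elim (∄f (d′ , eq))
  ... | no  _  = trans (ℤ.+-identityˡ _) (coeff-scale-∤ c d q e ∄f)

  -- Equivalent polynomials may list different terms, so the comparison is made coefficient by
  -- coefficient. At `e = d ⊕ f` both sides are `c` times the coefficient at `f`; if `d` does not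
  -- divide `e`, both vanish.
  scale-cong : ∀ t {p q} → p Pol.≈ q → map (t ·ₜ_) p Pol.≈ map (t ·ₜ_) q
  scale-cong (c , d) {p} {q} p≈q e with ⊕-divides? d e
  ... | yes (f , refl) = trans (coeff-scale c d p f)
    (trans (cong (c ℤ.*_) (p≈q f)) (sym (coeff-scale c d q f)))
  ... | no ∄f = trans (coeff-scale-∤ c d p e ∄f) (sym (coeff-scale-∤ c d q e ∄f))

  +-cong : ∀ {p p′ q q′} → p Pol.≈ p′ → q Pol.≈ q′ → p ++ q Pol.≈ p′ ++ q′
  +-cong {p} {p′} {q} {q′} p≈p′ q≈q′ e = trans (coeff-++ p q e)
    (trans (cong₂ ℤ._+_ (p≈p′ e) (q≈q′ e)) (sym (coeff-++ p′ q′ e)))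

  ++-congˡ : ∀ p q q′ → q Pol.≈ q′ → p ++ q Pol.≈ p ++ q′
  ++-congˡ p q q′ = +-cong {p} {p} {q} {q′} (λ _ → refl)

  +-comm : ∀ p q → p ++ q Pol.≈ q ++ p
  +-comm p q e = trans (coeff-++ p q e)
    (trans (ℤ.+-comm (coeff p e) _) (sym (coeff-++ q p e)))

  ≈-isEquivalence : IsEquivalence Pol._≈_
  ≈-isEquivalence = record
    { refl  = λ e → refl
    ; sym   = λ p≈q e → sym (p≈q e)
    ; trans = λ p≈q q≈r e → trans (p≈q e) (q≈r e)
    }

  ≡⇒≈ : ∀ {p q : Poly} → p ≡ q → p Pol.≈ q
  ≡⇒≈ eq e = cong (λ r → coeff r e) eq

  +-isCommutativeMonoid : IsCommutativeMonoid Pol._≈_ Pol._+_ Pol.0#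
  +-isCommutativeMonoid = isCommutativeMonoidˡ record
    { isSemigroup = record
      { isMagma = record
        { isEquivalence = ≈-isEquivalence
        ; ∙-cong        = λ {p} {p′} {q} {q′} → +-cong {p} {p′} {q} {q′}
        }
      ; assoc   = λ p q r → ≡⇒≈ (List.++-assoc p q r)
      }
    ; identityˡ = λ p e → refl
    ; comm      = +-comm
    }

  +-commutativeSemigroup : CommutativeSemigroup 0ℓ 0ℓ
  +-commutativeSemigroup = record
    { isCommutativeSemigroup = IsCommutativeMonoid.isCommutativeSemigroup +-isCommutativeMonoid }

  open import Algebra.Properties.CommutativeSemigroup +-commutativeSemigroup
    using (x∙yz≈y∙xz)

  *-congˡ : ∀ p {q q′} → q Pol.≈ q′ → p Pol.* q Pol.≈ p Pol.* q′
  *-congˡ []      q≈q′ e = refl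
  *-congˡ (t ∷ p) {q} {q′} q≈q′ =
    +-cong {map (t ·ₜ_) q} {map (t ·ₜ_) q′} {p Pol.* q} {p Pol.* q′}
      (scale-cong t {q} {q′} q≈q′) (*-congˡ p {q} {q′} q≈q′)

  -- The product runs through the left factor first, so this law, like associativity and the left
  -- unit, holds on the nose for lists. Laws that recurse on the right factor reorder terms and hold
  -- only up to `_≈_`.
  *-distribʳ : ∀ r p q → (p ++ q) Pol.* r ≡ (p Pol.* r) ++ (q Pol.* r)
  *-distribʳ r []      q = refl
  *-distribʳ r (t ∷ p) q =
    trans (cong (map (t ·ₜ_) r ++_) (*-distribʳ r p q)) (sym (List.++-assoc (map (t ·ₜ_) r) _ _))

  *-zeroʳ : ∀ p → p Pol.* [] ≡ []
  *-zeroʳ []      = refl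
  *-zeroʳ (t ∷ p) = *-zeroʳ p

  ·ₜ-comm : ∀ s t → s ·ₜ t ≡ t ·ₜ s
  ·ₜ-comm (c , d) (c′ , d′) = cong₂ _,_ (ℤ.*-comm c c′) (Vec.zipWith-comm ℕ.+-comm d d′)

  ·ₜ-assoc : ∀ s t u → (s ·ₜ t) ·ₜ u ≡ s ·ₜ (t ·ₜ u)
  ·ₜ-assoc (a , d) (b , e) (c , f) =
    cong₂ _,_ (ℤ.*-assoc a b c) (Vec.zipWith-assoc ℕ.+-assoc d e f)

  -- This is the recursion of the product on its right factor. Matched against the defining
  -- recursion on the left one, it yields commutativity by induction.
  *-∷ʳ : ∀ p t q → p Pol.* (t ∷ q) Pol.≈ map (t ·ₜ_) p ++ (p Pol.* q)
  *-∷ʳ []      t q e = refl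
  *-∷ʳ (s ∷ p) t q e = begin
    coeff (s ·ₜ t ∷ map (s ·ₜ_) q ++ (p Pol.* (t ∷ q))) e
      ≡⟨ cong (λ u → coeff (u ∷ map (s ·ₜ_) q ++ (p Pol.* (t ∷ q))) e) (·ₜ-comm s t) ⟩
    coeff (t ·ₜ s ∷ map (s ·ₜ_) q ++ (p Pol.* (t ∷ q))) e
      ≡⟨ ++-congˡ (t ·ₜ s ∷ map (s ·ₜ_) q) (p Pol.* (t ∷ q)) (map (t ·ₜ_) p ++ (p Pol.* q)) (*-∷ʳ p t q) e ⟩
    coeff (t ·ₜ s ∷ map (s ·ₜ_) q ++ (map (t ·ₜ_) p ++ (p Pol.* q))) e
      ≡⟨ ++-congˡ [ t ·ₜ s ] (map (s ·ₜ_) q ++ (map (t ·ₜ_) p ++ (p Pol.* q)))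
           (map (t ·ₜ_) p ++ (map (s ·ₜ_) q ++ (p Pol.* q)))
           (x∙yz≈y∙xz (map (s ·ₜ_) q) (map (t ·ₜ_) p) (p Pol.* q)) e ⟩
    coeff (t ·ₜ s ∷ map (t ·ₜ_) p ++ (map (s ·ₜ_) q ++ (p Pol.* q))) e ∎
    where open ≡-Reasoning

  *-comm : ∀ p q → p Pol.* q Pol.≈ q Pol.* p
  *-comm []      q e = cong (λ r → coeff r e) (sym (*-zeroʳ q))
  *-comm (t ∷ p) q e = trans
    (++-congˡ (map (t ·ₜ_) q) (p Pol.* q) (q Pol.* p) (*-comm p q) e) (sym (*-∷ʳ q t p e))

  *-cong : ∀ {p p′ q q′} → p Pol.≈ p′ → q Pol.≈ q′ → p Pol.* q Pol.≈ p′ Pol.* q′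
  *-cong {p} {p′} {q} {q′} p≈p′ q≈q′ e = trans (*-congˡ p {q} {q′} q≈q′ e)
    (trans (*-comm p q′ e) (trans (*-congˡ q′ {p} {p′} p≈p′ e) (*-comm q′ p′ e)))

  scale-* : ∀ t q r → map (t ·ₜ_) q Pol.* r ≡ map (t ·ₜ_) (q Pol.* r)
  scale-* t []      r = refl
  scale-* t (s ∷ q) r = trans
    (cong₂ _++_ (trans (List.map-cong (·ₜ-assoc t s) r) (List.map-∘ r)) (scale-* t q r))
    (sym (List.map-++ (t ·ₜ_) (map (s ·ₜ_) r) _))

  *-assoc : ∀ p q r → (p Pol.* q) Pol.* r ≡ p Pol.* (q Pol.* r)
  *-assoc []      q r = refl
  *-assoc (t ∷ p) q r = trans (*-distribʳ r (map (t ·ₜ_) q) _)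
    (cong₂ _++_ (scale-* t q r) (*-assoc p q r))

  *-identityˡ : ∀ p → Pol.1# Pol.* p ≡ p
  *-identityˡ p = trans (List.++-identityʳ _) (trans (List.map-cong identity p) (List.map-id p))
    where
    identity : ∀ t → (+ 1 , replicate 3 0) ·ₜ t ≡ t
    identity (c , d) = cong₂ _,_ (ℤ.*-identityˡ c) (Vec.zipWith-identityˡ ℕ.+-identityˡ d)

  *-isCommutativeMonoid : IsCommutativeMonoid Pol._≈_ Pol._*_ Pol.1#
  *-isCommutativeMonoid = isCommutativeMonoidˡ record
    { isSemigroup = record
      { isMagma = record
        { isEquivalence = ≈-isEquivalence
        ; ∙-cong        = λ {p} {p′} {q} {q′} → *-cong {p} {p′} {q} {q′}
        }
      ; assoc   = λ p q r → ≡⇒≈ (*-assoc p q r)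
      }
    ; identityˡ = λ p → ≡⇒≈ (*-identityˡ p)
    ; comm      = *-comm
    }

  polyCommutativeSemiring : CommutativeSemiring 0ℓ 0ℓ
  polyCommutativeSemiring = record
    { RawSemiring polyRawSemiring
    ; isCommutativeSemiring = isCommutativeSemiringˡ record
      { +-isCommutativeMonoid = +-isCommutativeMonoid
      ; *-isCommutativeMonoid = *-isCommutativeMonoid
      ; distribʳ              = λ r p q → ≡⇒≈ (*-distribʳ r p q)
      ; zeroˡ                 = λ p e → refl
      }
    }

-- Vectors and indices with a last element.

lookup-∷ʳ-inject₁ : ∀ {a} {A : Set a} {n} (xs : Vec A n) x i → lookup (xs ∷ʳ x) (inject₁ i) ≡ lookup xs i
lookup-∷ʳ-inject₁ (y ∷ xs) x Fin.zero    = refl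
lookup-∷ʳ-inject₁ (y ∷ xs) x (Fin.suc i) = lookup-∷ʳ-inject₁ xs x i

lookup-∷ʳ-fromℕ : ∀ {a} {A : Set a} {n} (xs : Vec A n) x → lookup (xs ∷ʳ x) (fromℕ n) ≡ x
lookup-∷ʳ-fromℕ []       x = refl
lookup-∷ʳ-fromℕ (y ∷ xs) x = lookup-∷ʳ-fromℕ xs x

inject₁<fromℕ : ∀ {n} (i : Fin n) → inject₁ i Fin.< fromℕ n
inject₁<fromℕ {n} i =
  subst (toℕ (inject₁ i) ℕ.<_) (sym (Fin.toℕ-fromℕ n)) (Fin.inject₁ℕ< i)

fromℕ≮ : ∀ {n} (i : Fin (suc n)) → ¬ (fromℕ n Fin.< i)
fromℕ≮ i = ℕ.≤⇒≯ (Fin.≤fromℕ i)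

inject₁-< : ∀ {n} {i j : Fin n} → inject₁ i Fin.< inject₁ j ⇔ i Fin.< j
inject₁-< {i = i} {j} = mk⇔ (subst id eq) (subst id (sym eq))
  where
  eq : (inject₁ i Fin.< inject₁ j) ≡ (i Fin.< j)
  eq = cong₂ ℕ._<_ (Fin.toℕ-inject₁ i) (Fin.toℕ-inject₁ j)

-- Appending one border step to a tableau.

south-or-west : ∀ s → s ≡ south ⊎ s ≡ west
south-or-west south = inj₁ refl
south-or-west west  = inj₂ refl

-- A form of `rowLabel` that depends only on the step and the position, so that it can be rewritten
-- along equations for either.
label : Step → ℕ → ℤ
label south a = + suc a
label west  a = -[1+ a ]

rowLabel-label : ∀ {n} (T : Tableau n) i → rowLabel T i ≡ label (lookup (Tableau.border T) i) (toℕ i)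
rowLabel-label T i with lookup (Tableau.border T) i
... | south = refl
... | west  = refl

rowLabel-injective : ∀ {n} (T : Tableau n) {i j} → rowLabel T i ≡ rowLabel T j → i ≡ j
rowLabel-injective T {i} {j} eq with lookup (Tableau.border T) i | lookup (Tableau.border T) j
... | south | south = Fin.toℕ-injective (ℕ.suc-injective (ℤ.+-injective eq))
... | west  | west  = Fin.toℕ-injective (ℤ.-[1+-injective eq)

-- The new row is false in the old columns, where it has no cells; d is the diagonal
-- cell of the new row if s is west.

extend : ∀ {n} → Tableau n → Step → Vec Bool n → Bool → Tableau (suc n)
extend (tableau b e) s c d = tableau (b ∷ʳ s) (zipWith _∷ʳ_ e c ∷ʳ (replicate _ false ∷ʳ d))

module Extension {n} (T : Tableau n) (s : Step) (c : Vec Bool n) (d : Bool) where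
  open Tableau T

  T⁺ : Tableau (suc n)
  T⁺ = extend T s c d

  new : Fin (suc n)
  new = fromℕ n

  border-old : ∀ i → lookup (Tableau.border T⁺) (inject₁ i) ≡ lookup border i
  border-old i = lookup-∷ʳ-inject₁ border s i

  border-new : lookup (Tableau.border T⁺) new ≡ s
  border-new = lookup-∷ʳ-fromℕ border s

  entry-row : ∀ i → lookup (Tableau.entries T⁺) (inject₁ i) ≡ lookup entries i ∷ʳ lookup c i
  entry-row i = trans (lookup-∷ʳ-inject₁ (zipWith _∷ʳ_ entries c) _ i) (Vec.lookup-zipWith _∷ʳ_ i entries c)

  entry-old : ∀ i j → entry T⁺ (inject₁ i) (inject₁ j) ≡ entry T i j
  entry-old i j = trans (cong (λ r → lookup r (inject₁ j)) (entry-row i))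
    (lookup-∷ʳ-inject₁ (lookup entries i) _ j)

  entry-column : ∀ i → entry T⁺ (inject₁ i) new ≡ lookup c i
  entry-column i = trans (cong (λ r → lookup r new) (entry-row i)) (lookup-∷ʳ-fromℕ (lookup entries i) _)

  entry-bottom : ∀ j → entry T⁺ new (inject₁ j) ≡ false
  entry-bottom j = trans (cong (λ r → lookup r (inject₁ j)) (lookup-∷ʳ-fromℕ (zipWith _∷ʳ_ entries c) _))
    (trans (lookup-∷ʳ-inject₁ (replicate n false) d j) (Vec.lookup-replicate j false))

  entry-corner : entry T⁺ new new ≡ d
  entry-corner = trans (cong (λ r → lookup r new) (lookup-∷ʳ-fromℕ (zipWith _∷ʳ_ entries c) _))
    (lookup-∷ʳ-fromℕ (replicate n false) d)

  cell-old : ∀ {i j} → Cell T⁺ (inject₁ i) (inject₁ j) ⇔ Cell T i j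
  cell-old {i} {j} = mk⇔ (subst id eq) (subst id (sym eq))
    where
    eq : Cell T⁺ (inject₁ i) (inject₁ j) ≡ Cell T i j
    eq rewrite border-old i | border-old j | Fin.toℕ-inject₁ i | Fin.toℕ-inject₁ j = refl

  -- A cell never has a column index below its row index, and `new` is the largest index. Hence the
  -- cells of the old columns are those of `T`, which is what makes the equivalences for old
  -- positions hold.
  ¬cell-bottom : ∀ {j} → ¬ Cell T⁺ new (inject₁ j)
  ¬cell-bottom {j} (_ , inj₁ (_ , n<j)) = fromℕ≮ (inject₁ j) n<j
  ¬cell-bottom {j} (_ , inj₂ (_ , n≤j)) = ℕ.<⇒≱ (inject₁<fromℕ j) n≤j

  cell-column : ∀ {i} → Cell T⁺ i new ⇔ s ≡ west
  cell-column {i} = mk⇔ (λ (w , _) → trans (sym border-new) w) cell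
    where
    cell : s ≡ west → Cell T⁺ i new
    cell w with view i
    ... | ‵fromℕ = trans border-new w , inj₂ (trans border-new w , ℕ.≤-refl)
    ... | ‵inject₁ j = trans border-new w ,
      Sum.map (_, inject₁<fromℕ j) (_, ℕ.<⇒≤ (inject₁<fromℕ j)) (south-or-west _)

  one-old : ∀ {i j} → One T⁺ (inject₁ i) (inject₁ j) ⇔ One T i j
  one-old {i} {j} = mk⇔
    (λ (cell , e) → to cell-old cell , trans (sym (entry-old i j)) e)
    (λ (cell , e) → from cell-old cell , trans (entry-old i j) e)

  zero-old : ∀ {i j} → Zero T⁺ (inject₁ i) (inject₁ j) ⇔ Zero T i j
  zero-old {i} {j} = mk⇔
    (λ (cell , e) → to cell-old cell , trans (sym (entry-old i j)) e)
    (λ (cell , e) → from cell-old cell , trans (entry-old i j) e)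

  rowLabel-old : ∀ i → rowLabel T⁺ (inject₁ i) ≡ rowLabel T i
  rowLabel-old i = trans (rowLabel-label T⁺ (inject₁ i))
    (trans (cong₂ label (border-old i) (Fin.toℕ-inject₁ i)) (sym (rowLabel-label T i)))

  rowLabel-new : rowLabel T⁺ new ≡ label s n
  rowLabel-new = trans (rowLabel-label T⁺ new) (cong₂ label border-new (Fin.toℕ-fromℕ n))

  above-old : ∀ {i j} → _AboveOf_ T⁺ (inject₁ i) (inject₁ j) ⇔ _AboveOf_ T i j
  above-old {i} {j} = mk⇔ (subst id eq) (subst id (sym eq))
    where
    eq : (_AboveOf_ T⁺ (inject₁ i) (inject₁ j)) ≡ (_AboveOf_ T i j)
    eq = cong₂ ℤ._<_ (rowLabel-old i) (rowLabel-old j)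

  -- After a west step the new row does lie above all old rows, but it has no cell in an old column.
  oneAbove-old : ∀ {i j} → OneAbove T⁺ (inject₁ i) (inject₁ j) ⇔ OneAbove T i j
  oneAbove-old {i} {j} = mk⇔ down λ (k , a , o) → inject₁ k , from above-old a , from one-old o
    where
    down : OneAbove T⁺ (inject₁ i) (inject₁ j) → OneAbove T i j
    down (k⁺ , a , o) with view k⁺
    ... | ‵fromℕ     = ⊥-elim (¬cell-bottom (proj₁ o))
    ... | ‵inject₁ k = k , to above-old a , to one-old o

  diagonal-old : ∀ {i j} → Diagonal T⁺ (inject₁ i) (inject₁ j) ⇔ Diagonal T i j
  diagonal-old {i} = mk⇔
    (λ (w , eq) → trans (sym (border-old i)) w , Fin.inject₁-injective eq)
    (λ (w , eq) → trans (border-old i) w , cong inject₁ eq)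

  diagonalOne-old : ∀ {i} → (Diagonal T⁺ (inject₁ i) (inject₁ i) × One T⁺ (inject₁ i) (inject₁ i)) ⇔
                            (Diagonal T i i × One T i i)
  diagonalOne-old = mk⇔ (λ (q , o) → to diagonal-old q , to one-old o)
                        (λ (q , o) → from diagonal-old q , from one-old o)

  -- Restriction looks only upwards in the column and at the diagonal, so a new leftmost column
  -- cannot affect it. `OneLeft`, in contrast, can change.
  restricted-old : ∀ {i j} → Restricted T⁺ (inject₁ i) (inject₁ j) ⇔ Restricted T i j
  restricted-old = mk⇔
    (λ (z , r) → to zero-old z , Sum.map (to oneAbove-old) (to diagonal-old) r)
    (λ (z , r) → from zero-old z , Sum.map (from oneAbove-old) (from diagonal-old) r)

  rightmostRestricted-old : ∀ {i j} →
    RightmostRestricted T⁺ (inject₁ i) (inject₁ j) ⇔ RightmostRestricted T i j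
  rightmostRestricted-old {i} {j} = mk⇔
    (λ (r , rightmost) → to restricted-old r ,
      λ j′ r′ → rightmost (inject₁ j′) (from restricted-old r′) ∘ from inject₁-<)
    (λ (r , rightmost) → from restricted-old r , up rightmost)
    where
    up : (∀ j′ → Restricted T i j′ → ¬ (j′ Fin.< j)) →
         ∀ j′ → Restricted T⁺ (inject₁ i) j′ → ¬ (j′ Fin.< inject₁ j)
    up rightmost j′ r′ lt with view j′
    ... | ‵fromℕ     = fromℕ≮ (inject₁ j) lt
    ... | ‵inject₁ k = rightmost k (to restricted-old r′) (to inject₁-< lt)

  unrestricted-old : ∀ {i} →
    Unrestricted T⁺ (inject₁ i) ⇔ (Unrestricted T i × ¬ Restricted T⁺ (inject₁ i) new)
  unrestricted-old {i} = mk⇔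
    (λ u → (λ (j , r) → u (inject₁ j , from restricted-old r)) , λ r → u (new , r))
    up
    where
    up : Unrestricted T i × ¬ Restricted T⁺ (inject₁ i) new → Unrestricted T⁺ (inject₁ i)
    up (u , ¬r) (j , r) with view j
    ... | ‵fromℕ     = ¬r r
    ... | ‵inject₁ k = u (k , to restricted-old r)

  -- The new column is leftmost, so a restricted 0 in it is the rightmost one of its row exactly
  -- when the row had no restricted 0 before.
  rightmostRestricted-column : ∀ {i} →
    RightmostRestricted T⁺ (inject₁ i) new ⇔ (Unrestricted T i × Restricted T⁺ (inject₁ i) new)
  rightmostRestricted-column {i} = mk⇔
    (λ (r , rightmost) →
      (λ (j , r′) → rightmost (inject₁ j) (from restricted-old r′) (inject₁<fromℕ j)) , r)
    (λ (u , r) → r , up u)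
    where
    up : Unrestricted T i → ∀ j′ → Restricted T⁺ (inject₁ i) j′ → ¬ (j′ Fin.< new)
    up u j′ r′ lt with view j′
    ... | ‵fromℕ     = fromℕ≮ new lt
    ... | ‵inject₁ k = u (k , to restricted-old r′)

  ¬diagonal-column : ∀ {i} → ¬ Diagonal T⁺ (inject₁ i) new
  ¬diagonal-column (_ , eq) = Fin.fromℕ≢inject₁ (sym eq)

  -- Every violation in `T` would persist in `T⁺`. A one witnessing an old column cannot lie in the
  -- new row, which has no cell there.
  isPTB-old : IsPTB T⁺ → IsPTB T
  isPTB-old p = isPTB
    (λ i j ¬cell → trans (sym (entry-old i j)) (supported (inject₁ i) (inject₁ j) (¬cell ∘ to cell-old)))
    column
    (λ i j z (a , (j′ , l , o)) → noZeroCorner (inject₁ i) (inject₁ j) (from zero-old z)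
      (from oneAbove-old a , inject₁ j′ , from inject₁-< l , from one-old o))
    (λ i j q z (j′ , l , o) → diagonalZero (inject₁ i) (inject₁ j) (from diagonal-old q) (from zero-old z)
      (inject₁ j′ , from inject₁-< l , from one-old o))
    where
    open IsPTB p
    column : ∀ j → IsColumn T j → ∃[ i ] One T i j
    column j w with columnHasOne (inject₁ j) (trans (border-old j) w)
    ... | i⁺ , o with view i⁺
    ...   | ‵fromℕ     = ⊥-elim (¬cell-bottom (proj₁ o))
    ...   | ‵inject₁ i = i , to one-old o

-- Extension by a south step: a new bottom row without cells.

module South {n} (T : Tableau n) where
  open Extension T south (replicate n false) false public

  ¬cell-new : ∀ {i} → ¬ Cell T⁺ i new
  ¬cell-new cell with () ← to cell-column cell

  ¬cell-row-new : ∀ {j} → ¬ Cell T⁺ new j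
  ¬cell-row-new {j} with view j
  ... | ‵fromℕ     = ¬cell-new
  ... | ‵inject₁ _ = ¬cell-bottom

  isPTB-new : IsPTB T → IsPTB T⁺
  isPTB-new p = isPTB supported⁺ column corner diagonal
    where
    open IsPTB p
    supported⁺ : ∀ i j → ¬ Cell T⁺ i j → entry T⁺ i j ≡ false
    supported⁺ i j ¬cell with view i | view j
    ... | ‵inject₁ i | ‵inject₁ j = trans (entry-old i j) (supported i j (¬cell ∘ from cell-old))
    ... | ‵inject₁ i | ‵fromℕ     = trans (entry-column i) (Vec.lookup-replicate i false)
    ... | ‵fromℕ     | ‵inject₁ j = entry-bottom j
    ... | ‵fromℕ     | ‵fromℕ     = entry-corner
    column : ∀ j → IsColumn T⁺ j → ∃[ i ] One T⁺ i j
    column j w with view j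
    ... | ‵fromℕ     with () ← trans (sym border-new) w
    ... | ‵inject₁ j with columnHasOne j (trans (sym (border-old j)) w)
    ...   | i , o = inject₁ i , from one-old o
    left-old : ∀ {i j} → OneLeft T⁺ (inject₁ i) (inject₁ j) → OneLeft T i j
    left-old (j′ , l , o) with view j′
    ... | ‵fromℕ     = ⊥-elim (¬cell-new (proj₁ o))
    ... | ‵inject₁ k = k , to inject₁-< l , to one-old o
    corner : ∀ i j → Zero T⁺ i j → ¬ (OneAbove T⁺ i j × OneLeft T⁺ i j)
    corner i j z (a , l) with view i | view j
    ... | ‵inject₁ i | ‵inject₁ j = noZeroCorner i j (to zero-old z) (to oneAbove-old a , left-old l)
    ... | ‵inject₁ i | ‵fromℕ     = ¬cell-new (proj₁ z)
    ... | ‵fromℕ     | _          = ¬cell-row-new (proj₁ z)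
    diagonal : ∀ i j → Diagonal T⁺ i j → Zero T⁺ i j → ¬ OneLeft T⁺ i j
    diagonal i j q z l with view i | view j
    ... | ‵inject₁ i | ‵inject₁ j = diagonalZero i j (to diagonal-old q) (to zero-old z) (left-old l)
    ... | ‵inject₁ i | ‵fromℕ     = ¬cell-new (proj₁ z)
    ... | ‵fromℕ     | _          = ¬cell-row-new (proj₁ z)

  old-above-new : ∀ {i} → _AboveOf_ T⁺ (inject₁ i) new
  old-above-new {i} rewrite rowLabel-new | rowLabel-label T⁺ (inject₁ i) | Fin.toℕ-inject₁ i
    with lookup (Tableau.border T⁺) (inject₁ i)
  ... | south = ℤ.+<+ (ℕ.s<s (Fin.toℕ<n i))
  ... | west  = ℤ.-<+

  unrestricted-new : Unrestricted T⁺ new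
  unrestricted-new (_ , (cell , _) , _) = ¬cell-row-new cell

-- Extension by a west step: a new leftmost column and a new top row.

module West {n} (T : Tableau n) (c : Vec Bool n) (d : Bool) where
  open Extension T west c d public

  -- The new row has label `-[1+ n ]`, smaller than every positive label and every negative label of
  -- an earlier step.
  new-above-old : ∀ {i} → _AboveOf_ T⁺ new (inject₁ i)
  new-above-old {i} rewrite rowLabel-new | rowLabel-label T⁺ (inject₁ i) | Fin.toℕ-inject₁ i
    with lookup (Tableau.border T⁺) (inject₁ i)
  ... | south = ℤ.-<+
  ... | west  = ℤ.-<- (Fin.toℕ<n i)

  one-column : ∀ {i} → One T⁺ (inject₁ i) new ⇔ lookup c i ≡ true
  one-column {i} = mk⇔ (λ (_ , e) → trans (sym (entry-column i)) e)
    (λ e → from cell-column refl , trans (entry-column i) e)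

  one-corner : One T⁺ new new ⇔ d ≡ true
  one-corner = mk⇔ (λ (_ , e) → trans (sym entry-corner) e)
    (λ e → from cell-column refl , trans entry-corner e)

  -- The new row is the top one, so a 1 in its diagonal cell lies above every other cell of the new
  -- column; any other 1 above is compared within `T`.
  oneAbove-column : ∀ {i} →
    OneAbove T⁺ (inject₁ i) new ⇔ (d ≡ true ⊎ ∃[ k ] (_AboveOf_ T k i × lookup c k ≡ true))
  oneAbove-column {i} = mk⇔ down λ where
      (inj₁ e)           → new , new-above-old , from one-corner e
      (inj₂ (k , a , e)) → inject₁ k , from above-old a , from one-column e
    where
    down : OneAbove T⁺ (inject₁ i) new → d ≡ true ⊎ ∃[ k ] (_AboveOf_ T k i × lookup c k ≡ true)
    down (k⁺ , a , o) with view k⁺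
    ... | ‵fromℕ     = inj₁ (to one-corner o)
    ... | ‵inject₁ k = inj₂ (k , to above-old a , to one-column o)

  restricted-column : ∀ {i} → Restricted T⁺ (inject₁ i) new ⇔
    (lookup c i ≡ false × (d ≡ true ⊎ ∃[ k ] (_AboveOf_ T k i × lookup c k ≡ true)))
  restricted-column {i} = mk⇔
    (λ where
      ((_ , e) , inj₁ a) → trans (sym (entry-column i)) e , to oneAbove-column a
      (_       , inj₂ q) → ⊥-elim (¬diagonal-column q))
    (λ (e , a) → (from cell-column refl , trans (entry-column i) e) , inj₁ (from oneAbove-column a))

  -- The condition on the new column that characterizes the type B extensions of a type B tableau:
  -- it is necessary by `admissible` and sufficient by `isPTB-new`.
  Admissible : Set
  Admissible = (∀ i → lookup c i ≡ true → Unrestricted T i) × (d ≡ true ⊎ ∃[ i ] lookup c i ≡ true)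

  -- A 1 in the new column lies to the left of all old cells of its row. A restricted 0 there would
  -- therefore violate `noZeroCorner` or `diagonalZero`, according to why it is restricted.
  admissible : IsPTB T⁺ → Admissible
  admissible p = unrestricted , some (columnHasOne new border-new)
    where
    open IsPTB p
    left : ∀ {i} j → lookup c i ≡ true → OneLeft T⁺ (inject₁ i) (inject₁ j)
    left j e = new , inject₁<fromℕ j , from one-column e
    unrestricted : ∀ i → lookup c i ≡ true → Unrestricted T i
    unrestricted i e (j , z , inj₁ a) =
      noZeroCorner (inject₁ i) (inject₁ j) (from zero-old z) (from oneAbove-old a , left j e)
    unrestricted i e (j , z , inj₂ q) =
      diagonalZero (inject₁ i) (inject₁ j) (from diagonal-old q) (from zero-old z) (left j e)
    some : ∃[ i ] One T⁺ i new → d ≡ true ⊎ ∃[ i ] lookup c i ≡ true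
    some (i⁺ , o) with view i⁺
    ... | ‵fromℕ     = inj₁ (to one-corner o)
    ... | ‵inject₁ i = inj₂ (i , to one-column o)

  isPTB-new : IsPTB T → Admissible → IsPTB T⁺
  isPTB-new p (unrestricted , some) = isPTB supported⁺ column corner diagonal
    where
    open IsPTB p
    supported⁺ : ∀ i j → ¬ Cell T⁺ i j → entry T⁺ i j ≡ false
    supported⁺ i j ¬cell with view i | view j
    ... | ‵inject₁ i | ‵inject₁ j = trans (entry-old i j) (supported i j (¬cell ∘ from cell-old))
    ... | _          | ‵fromℕ     = ⊥-elim (¬cell (from cell-column refl))
    ... | ‵fromℕ     | ‵inject₁ j = entry-bottom j
    column : ∀ j → IsColumn T⁺ j → ∃[ i ] One T⁺ i j
    column j w with view j
    ... | ‵fromℕ     =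
      [ (λ e → new , from one-corner e) , (λ (i , e) → inject₁ i , from one-column e) ]′ some
    ... | ‵inject₁ j with columnHasOne j (trans (sym (border-old j)) w)
    ...   | i , o = inject₁ i , from one-old o
    -- A row with a restricted 0 has no 1 in the new column, so the 1 to the left was already in
    -- `T`.
    left-old : ∀ {i j} → Restricted T i j → OneLeft T⁺ (inject₁ i) (inject₁ j) → OneLeft T i j
    left-old {i} {j} r (j′ , l , o) with view j′
    ... | ‵fromℕ     = ⊥-elim (unrestricted i (to one-column o) (j , r))
    ... | ‵inject₁ k = k , to inject₁-< l , to one-old o
    corner : ∀ i j → Zero T⁺ i j → ¬ (OneAbove T⁺ i j × OneLeft T⁺ i j)
    corner i j z (a , l) with view i | view j
    ... | ‵inject₁ i | ‵inject₁ j =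
      noZeroCorner i j z′ (a′ , left-old (z′ , inj₁ a′) l)
      where z′ = to zero-old z ; a′ = to oneAbove-old a
    ... | _          | ‵fromℕ     = fromℕ≮ _ (proj₁ (proj₂ l))
    ... | ‵fromℕ     | ‵inject₁ _ = ¬cell-bottom (proj₁ z)
    diagonal : ∀ i j → Diagonal T⁺ i j → Zero T⁺ i j → ¬ OneLeft T⁺ i j
    diagonal i j q z l with view i | view j
    ... | ‵inject₁ i | ‵inject₁ j =
      diagonalZero i j q′ z′ (left-old (z′ , inj₂ q′) l)
      where z′ = to zero-old z ; q′ = to diagonal-old q
    ... | _          | ‵fromℕ     = fromℕ≮ _ (proj₁ (proj₂ l))
    ... | ‵fromℕ     | ‵inject₁ _ = ¬cell-bottom (proj₁ z)

-- Counting

unique-⇔⇒↭ : ∀ {a} {A : Set a} {xs ys : List A} → Unique xs → Unique ys →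
              (∀ {x} → x ∈ xs ⇔ x ∈ ys) → xs ↭ ys
unique-⇔⇒↭ xs! ys! xs⇔ys = ∼bag⇒↭ (unique∧set⇒bag xs! ys! xs⇔ys)

Unique-resp-↭ : ∀ {a} {A : Set a} {xs ys : List A} → xs ↭ ys → Unique xs → Unique ys
Unique-resp-↭ p = Permutationₛ.Unique-resp-↭ (≡.setoid _) (↭⇒↭ₛ p)

module _ {p q} {n} {P : Pred (Fin n) p} {Q : Pred (Fin n) q} (P? : Decidable P) (Q? : Decidable Q) where

  count-cong : (∀ i → P i ⇔ Q i) → count P? ≡ count Q?
  count-cong P⇔Q = cong length
    (List.filter-≐ P? Q? ((λ {i} → to (P⇔Q i)) , (λ {i} → from (P⇔Q i))) (allFin n))

  -- Trades the enumeration by index for any duplicate-free list. Applied to the unrestricted rows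
  -- from top to bottom, it turns counts of rows into counts of bits.
  count-filter : ∀ {xs} → Unique xs → (∀ i → P i ⇔ (i ∈ xs × Q i)) → count P? ≡ length (filter Q? xs)
  count-filter {xs} xs! P⇔ = ↭-length (unique-⇔⇒↭
    (Unique.filter⁺ P? (Unique.allFin⁺ n)) (Unique.filter⁺ Q? xs!)
    (λ {i} → mk⇔
      (λ i∈ → let i∈xs , q = to (P⇔ i) (proj₂ (∈-filter⁻ P? {xs = allFin n} i∈)) in ∈-filter⁺ Q? i∈xs q)
      (λ i∈ → ∈-filter⁺ P? (∈-allFin i) (from (P⇔ i) (∈-filter⁻ Q? i∈)))))

count-none : ∀ {p n} {P : Pred (Fin n) p} (P? : Decidable P) → (∀ i → ¬ P i) → count P? ≡ 0
count-none {n = n} P? ¬P = cong length (List.filter-none P? {allFin n} (All.tabulate λ {i} _ → ¬P i))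

tabulate-∷ʳ : ∀ {a} {A : Set a} {n} (f : Fin (suc n) → A) →
              tabulate f ≡ tabulate (f ∘ inject₁) ++ [ f (fromℕ n) ]
tabulate-∷ʳ {n = zero}  f = refl
tabulate-∷ʳ {n = suc n} f = cong (f Fin.zero ∷_) (tabulate-∷ʳ (f ∘ Fin.suc))

length-filter-map : ∀ {a b p} {A : Set a} {B : Set b} {P : Pred B p} (P? : Decidable P) (f : A → B) xs →
                    length (filter P? (map f xs)) ≡ length (filter (P? ∘ f) xs)
length-filter-map P? f []       = refl
length-filter-map P? f (x ∷ xs) with P? (f x)
... | yes _ = cong suc (length-filter-map P? f xs)
... | no  _ = length-filter-map P? f xs

module _ {p n} {P : Pred (Fin (suc n)) p} (P? : Decidable P) where

  count-∷ʳ : count P? ≡ count (P? ∘ inject₁) ℕ.+ length (filter P? [ fromℕ n ])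
  count-∷ʳ = trans (cong (length ∘ filter P?) (tabulate-∷ʳ id))
    (trans (cong length (List.filter-++ P? (tabulate inject₁) [ fromℕ n ]))
    (trans (List.length-++ (filter P? (tabulate inject₁)))
    (cong (ℕ._+ length (filter P? [ fromℕ n ])) (trans
      (cong (length ∘ filter P?) (sym (List.map-tabulate id inject₁)))
      (length-filter-map P? inject₁ (allFin n))))))

  module _ {q} {Q : Pred (Fin n) q} (Q? : Decidable Q) (P⇔Q : ∀ i → P (inject₁ i) ⇔ Q i) where

    count-old : ¬ P (fromℕ n) → count P? ≡ count Q?
    count-old ¬p = trans count-∷ʳ (trans
      (cong₂ ℕ._+_ (count-cong (P? ∘ inject₁) Q? P⇔Q) (cong length (List.filter-reject P? ¬p)))
      (ℕ.+-identityʳ _))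

    count-new : P (fromℕ n) → count P? ≡ suc (count Q?)
    count-new p = trans count-∷ʳ (trans
      (cong₂ ℕ._+_ (count-cong (P? ∘ inject₁) Q? P⇔Q) (cong length (List.filter-accept P? p)))
      (ℕ.+-comm _ 1))

-- Bit vectors

bits : List Bool
bits = false ∷ true ∷ []

∈-bits : ∀ b → b ∈ bits
∈-bits false = here refl
∈-bits true  = there (here refl)

ones : ∀ {k} → Vec Bool k → ℕ
ones []          = 0
ones (true  ∷ s) = suc (ones s)
ones (false ∷ s) = ones s

zeros : ∀ {k} → Vec Bool k → ℕ
zeros []          = 0
zeros (true  ∷ s) = zeros s
zeros (false ∷ s) = suc (zeros s)

-- If the new diagonal cell is 0, a row with 0 in the new column becomes restricted
-- exactly when the column has a 1 further up.
survivors : ∀ {k} → Vec Bool k → ℕ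
survivors []          = 0
survivors (true  ∷ s) = suc (ones s)
survivors (false ∷ s) = suc (survivors s)

-- Built by the first bit instead of by filtering, so that sums over it satisfy a recursion in `k`.
nonzeroVecs : ∀ k → List (Vec Bool k)
nonzeroVecs zero    = []
nonzeroVecs (suc k) = map (false ∷_) (nonzeroVecs k) ++ map (true ∷_) (allVecs bits k)

∈-nonzeroVecs : ∀ {k} (s : Vec Bool k) → s ∈ nonzeroVecs k ⇔ VecAny.Any (_≡ true) s
∈-nonzeroVecs {zero} [] = mk⇔ (λ ()) (λ ())
∈-nonzeroVecs {suc k} (true ∷ s) = mk⇔ (λ _ → VecAny.here refl)
  (λ _ → ∈-++⁺ʳ (map (false ∷_) (nonzeroVecs k)) (∈-map⁺ (true ∷_) (allVecs-complete ∈-bits s)))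
∈-nonzeroVecs {suc k} (false ∷ s) = mk⇔ down
  (λ { (VecAny.there any) → ∈-++⁺ˡ (∈-map⁺ (false ∷_) (from (∈-nonzeroVecs s) any)) })
  where
  down : false ∷ s ∈ nonzeroVecs (suc k) → VecAny.Any (_≡ true) (false ∷ s)
  down s∈ with ∈-++⁻ (map (false ∷_) (nonzeroVecs k)) s∈
  ... | inj₁ s∈₀ with _ , s′∈ , refl ← ∈-map⁻ (false ∷_) s∈₀ = VecAny.there (to (∈-nonzeroVecs s) s′∈)
  ... | inj₂ s∈₁ with () ← proj₂ (proj₂ (∈-map⁻ (true ∷_) s∈₁))

allBits-unique : ∀ k → Unique (allVecs bits k)
allBits-unique = allVecs-unique (((λ ()) ∷ []) ∷ [] ∷ [])

nonzeroVecs-unique : ∀ k → Unique (nonzeroVecs k)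
nonzeroVecs-unique zero    = []
nonzeroVecs-unique (suc k) = Unique.++⁺
  (Unique.map⁺ Vec.∷-injectiveʳ (nonzeroVecs-unique k)) (Unique.map⁺ Vec.∷-injectiveʳ (allBits-unique k))
  λ (s∈₀ , s∈₁) → let _ , _ , eq₀ = ∈-map⁻ (false ∷_) s∈₀ ; _ , _ , eq₁ = ∈-map⁻ (true ∷_) s∈₁ in
    case trans (sym eq₀) eq₁ of λ ()

-- For duplicate-free `us`, `restrict` and `spread` are mutually inverse between the columns whose
-- ones lie in rows of `us` and the bit vectors of length `length us`.
restrict : ∀ {n} → Vec Bool n → (us : List (Fin n)) → Vec Bool (length us)
restrict c us = Vec.map (lookup c) (Vec.fromList us)

spread : ∀ {n} (us : List (Fin n)) → Vec Bool (length us) → Vec Bool n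
spread []       []      = replicate _ false
spread (u ∷ us) (b ∷ s) = spread us s [ u ]≔ b

lookup-spread-∉ : ∀ {n} us s {i : Fin n} → i ∉ us → lookup (spread us s) i ≡ false
lookup-spread-∉ []       []      {i} i∉ = Vec.lookup-replicate i false
lookup-spread-∉ (u ∷ us) (b ∷ s)     i∉ =
  trans (Vec.lookup∘update′ (i∉ ∘ here) (spread us s) b) (lookup-spread-∉ us s (i∉ ∘ there))

lookup-spread-restrict : ∀ {n} us (c : Vec Bool n) i → (lookup c i ≡ true → i ∈ us) →
                         lookup (spread us (restrict c us)) i ≡ lookup c i
lookup-spread-restrict [] c i c⊆us with lookup c i
... | false = Vec.lookup-replicate i false
... | true  with () ← c⊆us refl
lookup-spread-restrict (u ∷ us) c i c⊆us with i Fin.≟ u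
... | yes refl = Vec.lookup∘update i (spread us (restrict c us)) _
... | no  i≢u  = trans (Vec.lookup∘update′ i≢u (spread us (restrict c us)) _)
  (lookup-spread-restrict us c i λ e → Any.tail i≢u (c⊆us e))

lookup-injective : ∀ {a} {A : Set a} {n} {xs ys : Vec A n} → (∀ i → lookup xs i ≡ lookup ys i) → xs ≡ ys
lookup-injective {xs = xs} {ys} eq =
  trans (sym (Vec.tabulate∘lookup xs)) (trans (Vec.tabulate-cong eq) (Vec.tabulate∘lookup ys))

spread-restrict : ∀ {n} us (c : Vec Bool n) → (∀ i → lookup c i ≡ true → i ∈ us) →
                  spread us (restrict c us) ≡ c
spread-restrict us c c⊆us = lookup-injective λ i → lookup-spread-restrict us c i (c⊆us i)

spread-⊆ : ∀ {n} us s {i : Fin n} → lookup (spread us s) i ≡ true → i ∈ us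
spread-⊆ us s {i} e with Any.any? (i Fin.≟_) us
... | yes i∈ = i∈
... | no  i∉ with () ← trans (sym e) (lookup-spread-∉ us s i∉)

map-fromList-cong : ∀ {a b} {A : Set a} {B : Set b} {f g : A → B} xs → (∀ {x} → x ∈ xs → f x ≡ g x) →
                    Vec.map f (Vec.fromList xs) ≡ Vec.map g (Vec.fromList xs)
map-fromList-cong []       f≗g = refl
map-fromList-cong (x ∷ xs) f≗g = cong₂ _∷_ (f≗g (here refl)) (map-fromList-cong xs (f≗g ∘ there))

-- Distinctness of `us` matters: a repeated row would have its later bit overwritten by the earlier
-- one.
restrict-spread : ∀ {n} {us : List (Fin n)} → Unique us → ∀ s → restrict (spread us s) us ≡ s
restrict-spread []                []      = refl
restrict-spread {us = u ∷ us} (u∉ ∷ us!) (b ∷ s) = cong₂ _∷_ (Vec.lookup∘update u (spread us s) b)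
  (trans (map-fromList-cong us λ x∈ → Vec.lookup∘update′ (All.lookup u∉ x∈ ∘ sym) (spread us s) b)
    (restrict-spread us! s))

restrict-nonzero : ∀ {n} (c : Vec Bool n) us →
  restrict c us ∈ nonzeroVecs (length us) ⇔ Any (λ i → lookup c i ≡ true) us
restrict-nonzero c us = mk⇔
  (VecAny.fromList⁻ ∘ VecAny.map⁻ ∘ to (∈-nonzeroVecs (restrict c us)))
  (from (∈-nonzeroVecs (restrict c us)) ∘ VecAny.map⁺ ∘ VecAny.fromList⁺)

module _ {n q} {Q : Pred (Fin n) q} (Q? : Decidable Q) (c : Vec Bool n) where

  length-filter-ones : ∀ us → (∀ {i} → i ∈ us → Q i ⇔ lookup c i ≡ true) →
                       length (filter Q? us) ≡ ones (restrict c us)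
  length-filter-ones []       Q⇔ = refl
  length-filter-ones (u ∷ us) Q⇔ with lookup c u | Q⇔ (here refl)
  ... | true  | Qu = trans (cong length (List.filter-accept Q? (from Qu refl)))
    (cong suc (length-filter-ones us (Q⇔ ∘ there)))
  ... | false | Qu = trans (cong length (List.filter-reject Q? (λ q → case to Qu q of λ ())))
    (length-filter-ones us (Q⇔ ∘ there))

  length-filter-zeros : ∀ us → (∀ {i} → i ∈ us → Q i ⇔ lookup c i ≡ false) →
                        length (filter Q? us) ≡ zeros (restrict c us)
  length-filter-zeros []       Q⇔ = refl
  length-filter-zeros (u ∷ us) Q⇔ with lookup c u | Q⇔ (here refl)
  ... | false | Qu = trans (cong length (List.filter-accept Q? (from Qu refl)))
    (cong suc (length-filter-zeros us (Q⇔ ∘ there)))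
  ... | true  | Qu = trans (cong length (List.filter-reject Q? (λ q → case to Qu q of λ ())))
    (length-filter-zeros us (Q⇔ ∘ there))

  module _ {ℓ} {_≺_ : Rel (Fin n) ℓ} (≺-asym : ∀ {i j} → i ≺ j → ¬ (j ≺ i)) where

    -- Down to the first 1 every row satisfies `Q`, since nothing above it is a 1. Below that 1
    -- every 0 has a 1 above, so only the ones remain.
    length-filter-survivors : ∀ {us} → AllPairs _≺_ us →
      (∀ {i} → i ∈ us → Q i ⇔ (¬ (lookup c i ≡ false × Any (λ k → k ≺ i × lookup c k ≡ true) us))) →
      length (filter Q? us) ≡ survivors (restrict c us)
    length-filter-survivors []                Q⇔ = refl
    length-filter-survivors {u ∷ us} (u≺ ∷ us↗) Q⇔ with lookup c u in eq
    ... | true  = trans (cong length (List.filter-accept Q? Qu))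
      (cong suc (length-filter-ones us λ i∈ → mk⇔
        (λ q → Bool.¬-not λ e → to (Q⇔ (there i∈)) q (e , here (All.lookup u≺ i∈ , eq)))
        (λ e → from (Q⇔ (there i∈)) λ (e′ , _) → case trans (sym e) e′ of λ ())))
      where
      Qu = from (Q⇔ (here refl)) λ (e , _) → case trans (sym eq) e of λ ()
    ... | false = trans (cong length (List.filter-accept Q? Qu))
      (cong suc (length-filter-survivors us↗ λ i∈ → mk⇔
        (λ q (e , any) → to (Q⇔ (there i∈)) q (e , there any))
        (λ ¬r → from (Q⇔ (there i∈)) λ where
          (e , here (_ , e′)) → case trans (sym eq) e′ of λ ()
          (e , there any)     → ¬r (e , any))))
      where
      Qu = from (Q⇔ (here refl)) λ where
        (_ , here (_ , e′)) → case trans (sym eq) e′ of λ ()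
        -- The later rows of the list lie below `u`, so none of them can be above it.
        (_ , there any)     → let k , k∈ , k≺u , _ = find any in ≺-asym k≺u (All.lookup u≺ k∈)

-- Unrestricted rows, from top to bottom

module _ {n} (T : Tableau n) where

  private
    rowOrder : DecTotalOrder _ _ _
    rowOrder = On.decTotalOrder ℤ.≤-decTotalOrder (rowLabel T)

  open import Data.List.Sort rowOrder using (sort; sort-↭; sort-↗)

  abstract

    -- Sorting by row label puts the topmost unrestricted row at the head and lets bit vectors be
    -- read from top to bottom. The four properties that follow are all that is visible outside the
    -- `abstract` block.
    unrestrictedRows : List (Fin n)
    unrestrictedRows = sort (filter (unrestricted? T) (allFin n))

    unrestrictedRows-unique : Unique unrestrictedRows
    unrestrictedRows-unique =
      Unique-resp-↭ (↭-sym (sort-↭ _)) (Unique.filter⁺ (unrestricted? T) (Unique.allFin⁺ n))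

    ∈-unrestrictedRows : ∀ {i} → i ∈ unrestrictedRows ⇔ Unrestricted T i
    ∈-unrestrictedRows {i} = mk⇔
      (λ i∈ → proj₂ (∈-filter⁻ (unrestricted? T) {xs = allFin n} (∈-resp-↭ (sort-↭ _) i∈)))
      (λ u → ∈-resp-↭ (↭-sym (sort-↭ _)) (∈-filter⁺ (unrestricted? T) (∈-allFin i) u))

    length-unrestrictedRows : length unrestrictedRows ≡ urr T
    length-unrestrictedRows = ↭-length (sort-↭ _)

    -- Sorting gives only weakly increasing labels; they increase strictly because distinct rows
    -- have distinct labels.
    unrestrictedRows-sorted : AllPairs (_AboveOf_ T) unrestrictedRows
    unrestrictedRows-sorted = AllPairs.zipWith
      (λ (le , i≢j) → ℤ.≤∧≢⇒< le (i≢j ∘ rowLabel-injective T))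
      (Sorted.Sorted⇒AllPairs (DecTotalOrder.totalOrder rowOrder) (sort-↗ _) , unrestrictedRows-unique)

  -- `top₀₁` uses whichever topmost row the search returns. Of two topmost rows neither is above the
  -- other, so their labels and hence the rows agree.
  top₀₁-topmost : ∀ {m} → TopmostUnrestricted T m → top₀₁ T ≡ top₀₁At T m
  top₀₁-topmost {m} (u , top) with Fin.any? (topmostUnrestricted? T)
  ... | no  ∄m               = ⊥-elim (∄m (m , u , top))
  ... | yes (m′ , u′ , top′) with ℤ.<-cmp (rowLabel T m) (rowLabel T m′)
  ...   | tri< lt _ _ = ⊥-elim (top′ m u lt)
  ...   | tri> _ _ gt = ⊥-elim (top m′ u′ gt)
  ...   | tri≈ _ eq _ = cong (top₀₁At T) (sym (rowLabel-injective T eq))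

  head-topmost : ∀ {m us} → unrestrictedRows ≡ m ∷ us → TopmostUnrestricted T m
  head-topmost {m} {us} eq = to ∈-unrestrictedRows (subst (m ∈_) (sym eq) (here refl)) , top
    where
    m-above : All (_AboveOf_ T m) us
    m-above = AllPairs.head (subst (AllPairs (_AboveOf_ T)) eq unrestrictedRows-sorted)
    top : ∀ i → Unrestricted T i → ¬ (_AboveOf_ T i m)
    top i u lt with subst (i ∈_) eq (from ∈-unrestrictedRows u)
    ... | here refl = ℤ.<-irrefl refl lt
    ... | there i∈  = ℤ.<-asym lt (All.lookup m-above i∈)

  unrestrictedRows-nonempty : 1 ℕ.≤ urr T → ∃[ m ] ∃[ us ] unrestrictedRows ≡ m ∷ us
  unrestrictedRows-nonempty 1≤urr with unrestrictedRows | length-unrestrictedRows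
  ... | []     | eq with () ← subst (1 ℕ.≤_) (sym eq) 1≤urr
  ... | m ∷ us | _  = m , us , refl

-- Each tableau of positive length is a child of exactly one shorter tableau.

module _ {a} {A : Set a} {n : ℕ} where

  zipWith-∷ʳ-injective : ∀ {m} {e e′ : Vec (Vec A n) m} {c c′ : Vec A m} →
                         zipWith _∷ʳ_ e c ≡ zipWith _∷ʳ_ e′ c′ → e ≡ e′ × c ≡ c′
  zipWith-∷ʳ-injective {e = []}    {[]}     {[]}    {[]}     eq = refl , refl
  zipWith-∷ʳ-injective {e = r ∷ e} {r′ ∷ e′} {x ∷ c} {x′ ∷ c′} eq
    with refl , refl ← Vec.∷ʳ-injective r r′ (Vec.∷-injectiveˡ eq)
       | refl , refl ← zipWith-∷ʳ-injective {e = e} {e′} (Vec.∷-injectiveʳ eq) = refl , refl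

  zipWith-∷ʳ-surjective : ∀ {m} (e⁺ : Vec (Vec A (suc n)) m) → ∃[ e ] ∃[ c ] e⁺ ≡ zipWith _∷ʳ_ e c
  zipWith-∷ʳ-surjective []        = [] , [] , refl
  zipWith-∷ʳ-surjective (r⁺ ∷ e⁺) with initLast r⁺ | zipWith-∷ʳ-surjective e⁺
  ... | r , x , refl | e , c , refl = r ∷ e , x ∷ c , refl

extend-injective : ∀ {n} {T T′ : Tableau n} {s s′ c c′ d d′} → extend T s c d ≡ extend T′ s′ c′ d′ →
                   T ≡ T′ × s ≡ s′ × c ≡ c′ × d ≡ d′
extend-injective {T = tableau b e} {tableau b′ e′} {c = c} {c′} eq
  with refl , refl ← Vec.∷ʳ-injective b b′ (cong Tableau.border eq)
     | eq-rows , eq-bottom ← Vec.∷ʳ-injective (zipWith _∷ʳ_ e c) (zipWith _∷ʳ_ e′ c′)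
         (cong Tableau.entries eq)
  with refl , refl ← zipWith-∷ʳ-injective {e = e} {e′} eq-rows
     | refl ← Vec.∷ʳ-injectiveʳ (replicate _ false) (replicate _ false) eq-bottom
  = refl , refl , refl , refl

-- Splitting off last entries leaves an arbitrary vector `r` as the old part of the bottom row. None
-- of its positions is a cell, so `supported` forces it to be false.
extend-surjective : ∀ {n} {T⁺ : Tableau (suc n)} → IsPTB T⁺ →
                    ∃[ T ] ∃[ s ] ∃[ c ] ∃[ d ] T⁺ ≡ extend T s c d
extend-surjective {n} {tableau b⁺ e⁺} p with initLast b⁺ | initLast e⁺
... | b , s , refl | rows , r⁺ , refl with zipWith-∷ʳ-surjective rows | initLast r⁺
...   | e , c , refl | r , d , refl = tableau b e , s , c , d ,
  cong (λ r → tableau (b ∷ʳ s) (zipWith _∷ʳ_ e c ∷ʳ (r ∷ʳ d))) (lookup-injective λ j →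
    trans (sym (entry-bottom j)) (trans (IsPTB.supported p (fromℕ n) (inject₁ j) (¬cell-bottom j))
      (sym (Vec.lookup-replicate j false))))
  where
  entry-bottom : ∀ j → lookup (lookup (zipWith _∷ʳ_ e c ∷ʳ (r ∷ʳ d)) (fromℕ n)) (inject₁ j) ≡ lookup r j
  entry-bottom j = trans (cong (λ r → lookup r (inject₁ j)) (lookup-∷ʳ-fromℕ (zipWith _∷ʳ_ e c) _))
    (lookup-∷ʳ-inject₁ r d j)
  ¬cell-bottom : ∀ j → ¬ Cell (tableau (b ∷ʳ s) (zipWith _∷ʳ_ e c ∷ʳ (r ∷ʳ d))) (fromℕ n) (inject₁ j)
  ¬cell-bottom j (_ , inj₁ (_ , n<j)) = fromℕ≮ (inject₁ j) n<j
  ¬cell-bottom j (_ , inj₂ (_ , n≤j)) = ℕ.<⇒≱ (inject₁<fromℕ j) n≤j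

southChild : ∀ {n} → Tableau n → Tableau (suc n)
southChild T = extend T south (replicate _ false) false

westChild : ∀ {n} (T : Tableau n) → Bool → Vec Bool (length (unrestrictedRows T)) → Tableau (suc n)
westChild T d s = extend T west (spread (unrestrictedRows T) s) d

-- A diagonal 1 already provides the one that the new column must have, so all bit vectors occur;
-- under a diagonal 0 the zero vector is excluded.
westChildren children : ∀ {n} → Tableau n → List (Tableau (suc n))
westChildren T = map (westChild T true) (allVecs bits (length (unrestrictedRows T)))
              ++ map (westChild T false) (nonzeroVecs (length (unrestrictedRows T)))
children T = southChild T ∷ westChildren T

∈-westChildren⁻ : ∀ {n} {T : Tableau n} {T⁺} → T⁺ ∈ westChildren T → ∃[ c ] ∃[ d ] T⁺ ≡ extend T west c d
∈-westChildren⁻ {T = T} T⁺∈ with ∈-++⁻ (map (westChild T true) (allVecs bits _)) T⁺∈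
... | inj₁ ∈₁ with s , _ , eq ← ∈-map⁻ (westChild T true) ∈₁ = spread (unrestrictedRows T) s , true , eq
... | inj₂ ∈₀ with s , _ , eq ← ∈-map⁻ (westChild T false) ∈₀ = spread (unrestrictedRows T) s , false , eq

∈-children⁻ : ∀ {n} {T : Tableau n} {T⁺} → T⁺ ∈ children T → ∃[ s ] ∃[ c ] ∃[ d ] T⁺ ≡ extend T s c d
∈-children⁻         (here eq)   = south , replicate _ false , false , eq
∈-children⁻ {T = T} (there T⁺∈) = west , ∈-westChildren⁻ {T = T} T⁺∈

children-unique : ∀ {n} (T : Tableau n) → Unique (children T)
children-unique T = All.tabulate (λ T⁺∈ eq → let _ , _ , eq′ = ∈-westChildren⁻ {T = T} T⁺∈ in
    case proj₁ (proj₂ (extend-injective (trans eq eq′))) of λ ())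
  ∷ Unique.++⁺ (Unique.map⁺ westChild-injective (allBits-unique _))
               (Unique.map⁺ westChild-injective (nonzeroVecs-unique _))
               (λ (∈₁ , ∈₀) → let _ , _ , eq₁ = ∈-map⁻ (westChild T true) ∈₁
                                  _ , _ , eq₀ = ∈-map⁻ (westChild T false) ∈₀ in
                 case proj₂ (proj₂ (proj₂ (extend-injective (trans (sym eq₁) eq₀)))) of λ ())
  where
  westChild-injective : ∀ {d s s′} → westChild T d s ≡ westChild T d s′ → s ≡ s′
  westChild-injective {s = s} {s′} eq = trans (sym (restrict-spread us! s))
    (trans (cong (λ c → restrict c (unrestrictedRows T)) (proj₁ (proj₂ (proj₂ (extend-injective eq)))))
      (restrict-spread us! s′))
    where us! = unrestrictedRows-unique T

children-isPTB : ∀ {n} {T : Tableau n} {T⁺} → IsPTB T → T⁺ ∈ children T → IsPTB T⁺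
children-isPTB {T = T} p (here refl)  = South.isPTB-new T p
children-isPTB {T = T} p (there T⁺∈) with ∈-++⁻ (map (westChild T true) (allVecs bits _)) T⁺∈
... | inj₁ ∈₁ with s , _ , refl ← ∈-map⁻ (westChild T true) ∈₁ =
  West.isPTB-new T _ true p
    ((λ i → to (∈-unrestrictedRows T) ∘ spread-⊆ (unrestrictedRows T) s) , inj₁ refl)
... | inj₂ ∈₀ with s , s∈ , refl ← ∈-map⁻ (westChild T false) ∈₀ =
  West.isPTB-new T _ false p ((λ i → to (∈-unrestrictedRows T) ∘ spread-⊆ us s) , inj₂ some)
  where
  us = unrestrictedRows T
  some : ∃[ i ] lookup (spread us s) i ≡ true
  some = Any.satisfied (to (restrict-nonzero (spread us s) us)
    (subst (_∈ nonzeroVecs _) (sym (restrict-spread (unrestrictedRows-unique T) s)) s∈))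

-- After a south step the last column has no cells and must be false. After a west step `admissible`
-- confines its ones to unrestricted rows, so it is recovered from its restriction to them.
isPTB-children : ∀ {n} {T⁺ : Tableau (suc n)} → IsPTB T⁺ → ∃[ T ] (IsPTB T × T⁺ ∈ children T)
isPTB-children p with extend-surjective p
... | T , south , c , d , refl = T , isPTB-old p , here
  (cong₂ (extend T south)
    (lookup-injective λ i → trans (trans (sym (entry-column i)) (supported _ _ ¬cell))
      (sym (Vec.lookup-replicate i false)))
    (trans (sym entry-corner) (supported _ _ ¬cell)))
  where
  open Extension T south c d
  open IsPTB p
  ¬cell : ∀ {i} → ¬ Cell T⁺ i new
  ¬cell cell with () ← to cell-column cell
... | T , west , c , d , refl = T , isPTB-old p , there (west∈ d (proj₂ (admissible p)))
  where
  open West T c d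
  us = unrestrictedRows T
  c⊆us : ∀ i → lookup c i ≡ true → i ∈ us
  c⊆us i e = from (∈-unrestrictedRows T) (proj₁ (admissible p) i e)
  child : ∀ d → extend T west c d ≡ westChild T d (restrict c us)
  child d = cong (λ c → extend T west c d) (sym (spread-restrict us c c⊆us))
  west∈ : ∀ d → d ≡ true ⊎ (∃[ i ] lookup c i ≡ true) → extend T west c d ∈ westChildren T
  west∈ true  _ = subst (_∈ westChildren T) (sym (child true))
    (∈-++⁺ˡ (∈-map⁺ (westChild T true) (allVecs-complete ∈-bits (restrict c us))))
  west∈ false (inj₂ (i , e)) = subst (_∈ westChildren T) (sym (child false))
    (∈-++⁺ʳ (map (westChild T true) (allVecs bits _))
      (∈-map⁺ (westChild T false) (from (restrict-nonzero c us) (lose (c⊆us i e) e))))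

concatMap-unique : ∀ {a b} {A : Set a} {B : Set b} (f : A → List B) {xs} → Unique xs →
  (∀ x → Unique (f x)) → (∀ {x y z} → z ∈ f x → z ∈ f y → x ≡ y) → Unique (concatMap f xs)
concatMap-unique f {xs} xs! f! f-injective = Unique.concat⁺ (All.map⁺ (All.tabulate λ {x} _ → f! x))
  (AllPairs.map⁺ {f = f} (AllPairs.map (λ {x} {y} → disjoint {x} {y}) xs!))
  where
  disjoint : ∀ {x y} → x ≢ y → Disjoint (f x) (f y)
  disjoint x≢y (z∈fx , z∈fy) = x≢y (f-injective z∈fx z∈fy)

∈-concatMap : ∀ {a b} {A : Set a} {B : Set b} (f : A → List B) {xs y} →
              y ∈ concatMap f xs ⇔ (∃[ x ] (x ∈ xs × y ∈ f x))
∈-concatMap f = mk⇔ (λ y∈ → find (∈-concatMap⁻ f y∈)) (λ (x , x∈ , y∈) → ∈-concatMap⁺ f (lose x∈ y∈))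

∈-PTB-suc : ∀ {n} {T⁺ : Tableau (suc n)} → T⁺ ∈ PTB (suc n) ⇔ (∃[ T ] (T ∈ PTB n × T⁺ ∈ children T))
∈-PTB-suc {n} {T⁺} = mk⇔ down up
  where
  down : T⁺ ∈ PTB (suc n) → ∃[ T ] (T ∈ PTB n × T⁺ ∈ children T)
  down T⁺∈ with isPTB-children (to (∈-PTB {suc n} {T⁺}) T⁺∈)
  ... | T , p , T⁺∈T = T , from (∈-PTB {n} {T}) p , T⁺∈T
  up : ∃[ T ] (T ∈ PTB n × T⁺ ∈ children T) → T⁺ ∈ PTB (suc n)
  up (T , T∈ , T⁺∈T) = from (∈-PTB {suc n} {T⁺}) (children-isPTB {T = T} (to (∈-PTB {n} {T}) T∈) T⁺∈T)

-- Both lists are duplicate-free with the same members. The families of children are disjoint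
-- because `extend` is injective, so a child determines its parent.
PTB-suc : ∀ n → PTB (suc n) ↭ concatMap children (PTB n)
PTB-suc n = unique-⇔⇒↭ {xs = PTB (suc n)} {ys = concatMap children (PTB n)} (PTB-unique (suc n))
  (concatMap-unique children {xs = PTB n} (PTB-unique n) children-unique parent-unique)
  (λ {T⁺} → mk⇔ (λ T⁺∈ → from (∈-concatMap children {PTB n}) (to (∈-PTB-suc {n} {T⁺}) T⁺∈))
                (λ T⁺∈ → from (∈-PTB-suc {n} {T⁺}) (to (∈-concatMap children {PTB n}) T⁺∈)))
  where
  parent-unique : ∀ {T T′ T⁺} → T⁺ ∈ children T → T⁺ ∈ children T′ → T ≡ T′
  parent-unique {T} {T′} ∈₁ ∈₂ with ∈-children⁻ {T = T} ∈₁ | ∈-children⁻ {T = T′} ∈₂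
  ... | _ , _ , _ , eq₁ | _ , _ , _ , eq₂ = proj₁ (extend-injective (trans (sym eq₁) eq₂))

-- The statistics of the children.

-- The statistics are computed for any U ≡ T⁺, so that they apply to the children of T
-- without urr, top₀₁ and diag being unfolded.
module SouthStatistics {n} (T : Tableau n) where
  open South T

  urr-south : ∀ U → U ≡ T⁺ → urr U ≡ suc (urr T)
  urr-south _ refl = count-new (unrestricted? T⁺) (unrestricted? T)
    (λ i → mk⇔ (proj₁ ∘ to unrestricted-old)
      (λ u → from unrestricted-old (u , λ ((cell , _) , _) → ¬cell-new cell)))
    unrestricted-new

  diag-south : ∀ U → U ≡ T⁺ → diag U ≡ diag T
  diag-south _ refl =
    count-old (λ i → diagonal? T⁺ i i ×-dec one? T⁺ i i) (λ i → diagonal? T i i ×-dec one? T i i)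
      (λ i → diagonalOne-old)
      (λ (_ , cell , _) → ¬cell-new cell)

  -- The new row lies at the bottom, so `m` stays topmost, and no cell is added to its row or to its
  -- column.
  top₀₁-south : ∀ {m} → TopmostUnrestricted T m → ∀ U → U ≡ T⁺ → top₀₁ U ≡ top₀₁ T
  top₀₁-south {m} (u , top) _ refl = trans (top₀₁-topmost T⁺ (u⁺ , top⁺)) (trans
    (cong₂ ℕ._+_
      (count-old (λ j → one? T⁺ (inject₁ m) j ×-dec ¬? (diagonal? T⁺ (inject₁ m) j))
        (λ j → one? T m j ×-dec ¬? (diagonal? T m j))
        (λ j → mk⇔ (λ (o , ¬q) → to one-old o , ¬q ∘ from diagonal-old)
                   (λ (o , ¬q) → from one-old o , ¬q ∘ to diagonal-old))
        (λ ((cell , _) , _) → ¬cell-new cell))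
      (count-old (λ i → rightmostRestricted? T⁺ i (inject₁ m)) (λ i → rightmostRestricted? T i m)
        (λ i → rightmostRestricted-old)
        (λ (((cell , _) , _) , _) → ¬cell-row-new cell)))
    (sym (top₀₁-topmost T (u , top))))
    where
    u⁺ : Unrestricted T⁺ (inject₁ m)
    u⁺ = from unrestricted-old (u , λ ((cell , _) , _) → ¬cell-new cell)
    top⁺ : ∀ i → Unrestricted T⁺ i → ¬ (_AboveOf_ T⁺ i (inject₁ m))
    top⁺ i u′ above with view i
    ... | ‵fromℕ     = ℤ.<-asym above old-above-new
    ... | ‵inject₁ k = top k (proj₁ (to unrestricted-old u′)) (to above-old above)

module DiagonalOneStatistics {n} (T : Tableau n) (c : Vec Bool n) where
  open West T c true

  private
    us = unrestrictedRows T

    restricted⇔ : ∀ {i} → Restricted T⁺ (inject₁ i) new ⇔ lookup c i ≡ false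
    restricted⇔ = mk⇔ (proj₁ ∘ to restricted-column) (λ e → from restricted-column (e , inj₁ refl))

    unrestricted⇔ : ∀ i → Unrestricted T⁺ (inject₁ i) ⇔ (Unrestricted T i × lookup c i ≡ true)
    unrestricted⇔ i = mk⇔
      (λ u → let v , ¬r = to unrestricted-old u in v , Bool.¬-not (¬r ∘ from restricted⇔))
      (λ (v , e) → from unrestricted-old (v , λ r → case trans (sym e) (to restricted⇔ r) of λ ()))

    ¬zero-corner : ¬ Zero T⁺ new new
    ¬zero-corner (_ , e) = case trans (sym e) entry-corner of λ ()

    unrestricted-new : Unrestricted T⁺ new
    unrestricted-new (j , z , _) with view j
    ... | ‵fromℕ     = ¬zero-corner z
    ... | ‵inject₁ _ = ¬cell-bottom (proj₁ z)

  urr-west₁ : ∀ U → U ≡ T⁺ → urr U ≡ suc (ones (restrict c us))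
  urr-west₁ _ refl = trans
    (count-new (unrestricted? T⁺) (λ i → unrestricted? T i ×-dec lookup c i Bool.≟ true)
      unrestricted⇔ unrestricted-new)
    (cong suc (trans
      (count-filter _ (λ i → lookup c i Bool.≟ true) (unrestrictedRows-unique T)
        (λ i → mk⇔ (map₁ (from (∈-unrestrictedRows T))) (map₁ (to (∈-unrestrictedRows T)))))
      (length-filter-ones _ c us λ _ → mk⇔ id id)))

  diag-west₁ : ∀ U → U ≡ T⁺ → diag U ≡ suc (diag T)
  diag-west₁ _ refl =
    count-new (λ i → diagonal? T⁺ i i ×-dec one? T⁺ i i) (λ i → diagonal? T i i ×-dec one? T i i)
      (λ i → diagonalOne-old)
      ((border-new , refl) , from one-corner refl)

  -- The new row is now topmost and consists of its diagonal cell, so the first summand vanishes.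
  -- The diagonal 1 restricts every 0 below it, and such a 0 is rightmost exactly in the rows that
  -- were unrestricted in `T`.
  top₀₁-west₁ : ∀ U → U ≡ T⁺ → top₀₁ U ≡ zeros (restrict c us)
  top₀₁-west₁ _ refl = trans (top₀₁-topmost T⁺ (unrestricted-new , top))
    (cong₂ ℕ._+_ (count-none (λ j → one? T⁺ new j ×-dec ¬? (diagonal? T⁺ new j)) ¬one) (trans
      (count-old (λ i → rightmostRestricted? T⁺ i new)
        (λ i → unrestricted? T i ×-dec lookup c i Bool.≟ false)
        (λ i → mk⇔ (map₂ (to restricted⇔) ∘ to rightmostRestricted-column)
                   (from rightmostRestricted-column ∘ map₂ (from restricted⇔)))
        (λ ((z , _) , _) → ¬zero-corner z))
      (trans
        (count-filter _ (λ i → lookup c i Bool.≟ false) (unrestrictedRows-unique T)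
          (λ i → mk⇔ (map₁ (from (∈-unrestrictedRows T))) (map₁ (to (∈-unrestrictedRows T)))))
        (length-filter-zeros _ c us λ _ → mk⇔ id id))))
    where
    top : ∀ i → Unrestricted T⁺ i → ¬ (_AboveOf_ T⁺ i new)
    top i _ above with view i
    ... | ‵fromℕ     = ℤ.<-irrefl refl above
    ... | ‵inject₁ k = ℤ.<-asym above new-above-old
    ¬one : ∀ j → ¬ (One T⁺ new j × ¬ Diagonal T⁺ new j)
    ¬one j (o , ¬q) with view j
    ... | ‵fromℕ     = ¬q (border-new , refl)
    ... | ‵inject₁ _ = ¬cell-bottom (proj₁ o)

module DiagonalZeroStatistics {n} (T : Tableau n) (c : Vec Bool n)
  (c⊆us : ∀ i → lookup c i ≡ true → Unrestricted T i) where
  open West T c false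

  private
    us = unrestrictedRows T

    -- A 0 in a diagonal cell is restricted by definition.
    restricted-new : ¬ Unrestricted T⁺ new
    restricted-new u = u (new , (from cell-column refl , entry-corner) , inj₂ (border-new , refl))

    restricted⇔ : ∀ {i} → Restricted T⁺ (inject₁ i) new ⇔
      (lookup c i ≡ false × Any (λ k → _AboveOf_ T k i × lookup c k ≡ true) us)
    restricted⇔ = mk⇔
      (λ r → case to restricted-column r of λ where
        (e , inj₂ (k , a , e′)) → e , lose (from (∈-unrestrictedRows T) (c⊆us k e′)) (a , e′))
      (λ (e , any) → from restricted-column (e , inj₂ (Any.satisfied any)))

  urr-west₀ : ∀ U → U ≡ T⁺ → urr U ≡ survivors (restrict c us)
  urr-west₀ _ refl = trans
    (count-old (unrestricted? T⁺) (λ i → unrestricted? T i ×-dec ¬? (restricted? T⁺ (inject₁ i) new))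
      (λ i → unrestricted-old) restricted-new)
    (trans
      (count-filter _ (λ i → ¬? (restricted? T⁺ (inject₁ i) new)) (unrestrictedRows-unique T)
        (λ i → mk⇔ (map₁ (from (∈-unrestrictedRows T))) (map₁ (to (∈-unrestrictedRows T)))))
      (length-filter-survivors _ c (ℤ.<-asym) (unrestrictedRows-sorted T)
        λ _ → mk⇔ (_∘ from restricted⇔) (_∘ to restricted⇔)))

  diag-west₀ : ∀ U → U ≡ T⁺ → diag U ≡ diag T
  diag-west₀ _ refl =
    count-old (λ i → diagonal? T⁺ i i ×-dec one? T⁺ i i) (λ i → diagonal? T i i ×-dec one? T i i)
      (λ i → diagonalOne-old)
      (λ (_ , o) → case to one-corner o of λ ())

  module _ {m} (topmost : TopmostUnrestricted T m) where

    private
      -- A 0 of row `m` in the new column could be restricted only by a 1 above it. That 1 would lie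
      -- in an unrestricted row of `T` above `m`.
      topmost⁺ : TopmostUnrestricted T⁺ (inject₁ m)
      topmost⁺ = from unrestricted-old (proj₁ topmost , ¬restricted) , top
        where
        ¬restricted : ¬ Restricted T⁺ (inject₁ m) new
        ¬restricted r with to restricted-column r
        ... | _ , inj₂ (k , a , e) = proj₂ topmost k (c⊆us k e) a
        top : ∀ i → Unrestricted T⁺ i → ¬ (_AboveOf_ T⁺ i (inject₁ m))
        top i u above with view i
        ... | ‵fromℕ     = restricted-new u
        ... | ‵inject₁ k = proj₂ topmost k (proj₁ (to unrestricted-old u)) (to above-old above)

      row⇔ : ∀ j → (One T⁺ (inject₁ m) (inject₁ j) × ¬ Diagonal T⁺ (inject₁ m) (inject₁ j)) ⇔
                   (One T m j × ¬ Diagonal T m j)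
      row⇔ j = mk⇔ (λ (o , ¬q) → to one-old o , ¬q ∘ from diagonal-old)
                   (λ (o , ¬q) → from one-old o , ¬q ∘ to diagonal-old)

      column : count (λ i → rightmostRestricted? T⁺ i (inject₁ m)) ≡
               count (λ i → rightmostRestricted? T i m)
      column = count-old (λ i → rightmostRestricted? T⁺ i (inject₁ m)) (λ i → rightmostRestricted? T i m)
        (λ i → rightmostRestricted-old)
        (λ (((cell , _) , _) , _) → ¬cell-bottom cell)

    top₀₁-west₀-one : lookup c m ≡ true → ∀ U → U ≡ T⁺ → top₀₁ U ≡ suc (top₀₁ T)
    top₀₁-west₀-one e _ refl = trans (top₀₁-topmost T⁺ topmost⁺) (trans
      (cong₂ ℕ._+_ (count-new (λ j → one? T⁺ (inject₁ m) j ×-dec ¬? (diagonal? T⁺ (inject₁ m) j))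
        (λ j → one? T m j ×-dec ¬? (diagonal? T m j)) row⇔ (from one-column e , ¬diagonal-column)) column)
      (cong suc (sym (top₀₁-topmost T topmost))))

    top₀₁-west₀-zero : lookup c m ≡ false → ∀ U → U ≡ T⁺ → top₀₁ U ≡ top₀₁ T
    top₀₁-west₀-zero e _ refl = trans (top₀₁-topmost T⁺ topmost⁺) (trans
      (cong₂ ℕ._+_ (count-old (λ j → one? T⁺ (inject₁ m) j ×-dec ¬? (diagonal? T⁺ (inject₁ m) j))
        (λ j → one? T m j ×-dec ¬? (diagonal? T m j)) row⇔
        (λ (o , _) → case trans (sym e) (to one-column o) of λ ())) column)
      (sym (top₀₁-topmost T topmost)))

module _ {n} (T : Tableau n) where

  private
    us = unrestrictedRows T

    restrict-spread-us : ∀ s → restrict (spread us s) us ≡ s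
    restrict-spread-us = restrict-spread (unrestrictedRows-unique T)

    spread-us-⊆ : ∀ s i → lookup (spread us s) i ≡ true → Unrestricted T i
    spread-us-⊆ s i = to (∈-unrestrictedRows T) ∘ spread-⊆ us s

  urr-westChild₁ : ∀ s → urr (westChild T true s) ≡ suc (ones s)
  urr-westChild₁ s = trans (DiagonalOneStatistics.urr-west₁ T (spread us s) (westChild T true s) refl)
    (cong (suc ∘ ones) (restrict-spread-us s))

  top₀₁-westChild₁ : ∀ s → top₀₁ (westChild T true s) ≡ zeros s
  top₀₁-westChild₁ s = trans (DiagonalOneStatistics.top₀₁-west₁ T (spread us s) (westChild T true s) refl)
    (cong zeros (restrict-spread-us s))

  diag-westChild₁ : ∀ s → diag (westChild T true s) ≡ suc (diag T)
  diag-westChild₁ s = DiagonalOneStatistics.diag-west₁ T (spread us s) (westChild T true s) refl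

  urr-westChild₀ : ∀ s → urr (westChild T false s) ≡ survivors s
  urr-westChild₀ s = trans (DiagonalZeroStatistics.urr-west₀ T (spread us s) (spread-us-⊆ s) (westChild T false s) refl)
    (cong survivors (restrict-spread-us s))

  diag-westChild₀ : ∀ s → diag (westChild T false s) ≡ diag T
  diag-westChild₀ s =
    DiagonalZeroStatistics.diag-west₀ T (spread us s) (spread-us-⊆ s) (westChild T false s) refl

-- Guarantees a topmost unrestricted row and an exact `∸ 1` in the weight. The new row is
-- unrestricted after a south step or a diagonal 1; under a diagonal 0 the first row of the parent's
-- list survives.
1≤urr : ∀ {n} {T⁺ : Tableau (suc n)} → IsPTB T⁺ → 1 ℕ.≤ urr T⁺
1≤urr {n} {T⁺} p with isPTB-children p
... | T , _ , here eq    = subst (1 ℕ.≤_) (sym (SouthStatistics.urr-south T T⁺ eq)) (ℕ.s≤s ℕ.z≤n)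
... | T , _ , there T⁺∈ with ∈-++⁻ (map (westChild T true) (allVecs bits _)) T⁺∈
...   | inj₁ ∈₁ with s , _ , eq ← ∈-map⁻ (westChild T true) ∈₁ =
  subst (1 ℕ.≤_) (sym (trans (cong urr eq) (urr-westChild₁ T s))) (ℕ.s≤s ℕ.z≤n)
...   | inj₂ ∈₀ with s , s∈ , eq ← ∈-map⁻ (westChild T false) ∈₀ =
  subst (1 ℕ.≤_) (sym (trans (cong urr eq) (urr-westChild₀ T s))) (1≤survivors s s∈)
  where
  -- The empty vector is ruled out because `nonzeroVecs 0` is empty.
  1≤survivors : ∀ {k} (s : Vec Bool k) → s ∈ nonzeroVecs k → 1 ℕ.≤ survivors s
  1≤survivors (true  ∷ s) _ = ℕ.s≤s ℕ.z≤n
  1≤survivors (false ∷ s) _ = ℕ.s≤s ℕ.z≤n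

bit : Bool → ℕ
bit false = 0
bit true  = 1

-- The bit of the topmost unrestricted row, which heads the list of rows.
leading : ∀ {k} → Vec Bool k → ℕ
leading []      = 0
leading (b ∷ _) = bit b

top₀₁-southChild : ∀ {n} (T : Tableau n) → 1 ℕ.≤ urr T → top₀₁ (southChild T) ≡ top₀₁ T
top₀₁-southChild T 1≤urr =
  let m , us , eq = unrestrictedRows-nonempty T 1≤urr in
  SouthStatistics.top₀₁-south T (head-topmost T eq) (southChild T) refl

top₀₁-westChild₀ : ∀ {n} (T : Tableau n) → 1 ℕ.≤ urr T → ∀ s →
                   top₀₁ (westChild T false s) ≡ leading s ℕ.+ top₀₁ T
top₀₁-westChild₀ {n} T 1≤urr s =
  let m , us′ , eq = unrestrictedRows-nonempty T 1≤urr in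
  trans (top₀₁-bit eq _ refl) (cong (ℕ._+ top₀₁ T) (leading-s (sym eq)))
  where
  us = unrestrictedRows T
  c  = spread us s
  open DiagonalZeroStatistics T c (λ i → to (∈-unrestrictedRows T) ∘ spread-⊆ us s)
  top₀₁-bit : ∀ {m us′} → us ≡ m ∷ us′ → ∀ b → lookup c m ≡ b →
             top₀₁ (westChild T false s) ≡ bit b ℕ.+ top₀₁ T
  top₀₁-bit eq true  e = top₀₁-west₀-one (head-topmost T eq) e (westChild T false s) refl
  top₀₁-bit eq false e = top₀₁-west₀-zero (head-topmost T eq) e (westChild T false s) refl
  leading-s : ∀ {vs} → vs ≡ us → leading (restrict c vs) ≡ leading s
  leading-s refl = cong leading (restrict-spread (unrestrictedRows-unique T) s)

-- Generating functions and their recursion.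

module GeneratingFunction {c ℓ} (R : CommutativeSemiring c ℓ) where
  open CommutativeSemiring R renaming (refl to ≈-refl; sym to ≈-sym; trans to ≈-trans)
  open import Algebra.Definitions.RawSemiring rawSemiring using (_^_) renaming (_×_ to _·_)
  open import Algebra.Properties.Semiring.Exp semiring using (^-congˡ)
  open import Algebra.Properties.CommutativeSemigroup +-commutativeSemigroup
    using () renaming (x∙yz≈y∙xz to x+[y+z]≈y+[x+z]; interchange to +-interchange)
  open import Algebra.Properties.CommutativeSemigroup *-commutativeSemigroup using (x∙yz≈y∙xz)
  open import Algebra.Solver.Ring.NaturalCoefficients.Default R using (solve; _:=_; _:+_; _:*_; con)
  open import Relation.Binary.Reasoning.Setoid setoid

  ∑ : ∀ {a} {A : Set a} → List A → (A → Carrier) → Carrier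
  ∑ = sumOver rawSemiring

  module _ {a} {A : Set a} where

    ∑-cong : ∀ {f g : A → Carrier} as → (∀ {a} → a ∈ as → f a ≈ g a) → ∑ as f ≈ ∑ as g
    ∑-cong []       f≈g = ≈-refl
    ∑-cong (a ∷ as) f≈g = +-cong (f≈g (here refl)) (∑-cong as (f≈g ∘ there))

    ∑-++ : ∀ (f : A → Carrier) as {bs} → ∑ (as ++ bs) f ≈ ∑ as f + ∑ bs f
    ∑-++ f []       = ≈-sym (+-identityˡ _)
    ∑-++ f (a ∷ as) = ≈-trans (+-congˡ (∑-++ f as)) (≈-sym (+-assoc _ _ _))

    ∑-map : ∀ {b} {B : Set b} (h : B → A) {f : A → Carrier} bs → ∑ (map h bs) f ≈ ∑ bs (f ∘ h)
    ∑-map h []       = ≈-refl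
    ∑-map h (b ∷ bs) = +-congˡ (∑-map h bs)

    ∑-concatMap : ∀ {b} {B : Set b} (h : B → List A) {f : A → Carrier} bs →
                  ∑ (concatMap h bs) f ≈ ∑ bs (λ b → ∑ (h b) f)
    ∑-concatMap h     []       = ≈-refl
    ∑-concatMap h {f} (b ∷ bs) = ≈-trans (∑-++ f (h b)) (+-congˡ (∑-concatMap h bs))

    ∑-↭ : ∀ {f : A → Carrier} {as bs} → as ↭ bs → ∑ as f ≈ ∑ bs f
    ∑-↭ ↭.refl         = ≈-refl
    ∑-↭ (↭.prep a p)   = +-congˡ (∑-↭ p)
    ∑-↭ (↭.swap a b p) = ≈-trans (x+[y+z]≈y+[x+z] _ _ _) (+-congˡ (+-congˡ (∑-↭ p)))
    ∑-↭ (↭.trans p q)  = ≈-trans (∑-↭ p) (∑-↭ q)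

    *-distribˡ-∑ : ∀ r (f : A → Carrier) as → ∑ as (λ a → r * f a) ≈ r * ∑ as f
    *-distribˡ-∑ r f []       = ≈-sym (zeroʳ r)
    *-distribˡ-∑ r f (a ∷ as) = ≈-trans (+-congˡ (*-distribˡ-∑ r f as)) (≈-sym (distribˡ r _ _))

    ∑-+ : ∀ (f g : A → Carrier) as → ∑ as (λ a → f a + g a) ≈ ∑ as f + ∑ as g
    ∑-+ f g []       = ≈-sym (+-identityˡ _)
    ∑-+ f g (a ∷ as) = ≈-trans (+-congˡ (∑-+ f g as)) (+-interchange _ _ _ _)

  ∑-allBits-suc : ∀ k (f : Vec Bool (suc k) → Carrier) →
    ∑ (allVecs bits (suc k)) f ≈ ∑ (allVecs bits k) (f ∘ (false ∷_)) + ∑ (allVecs bits k) (f ∘ (true ∷_))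
  ∑-allBits-suc k f = ≈-trans (∑-++ f (map (false ∷_) (allVecs bits k)))
    (+-cong (∑-map (false ∷_) (allVecs bits k)) (≈-trans (∑-++ f (map (true ∷_) (allVecs bits k)))
      (≈-trans (+-identityʳ _) (∑-map (true ∷_) (allVecs bits k)))))

  ∑-nonzero-suc : ∀ k (f : Vec Bool (suc k) → Carrier) →
    ∑ (nonzeroVecs (suc k)) f ≈ ∑ (nonzeroVecs k) (f ∘ (false ∷_)) + ∑ (allVecs bits k) (f ∘ (true ∷_))
  ∑-nonzero-suc k f = ≈-trans (∑-++ f (map (false ∷_) (nonzeroVecs k)))
    (+-cong (∑-map (false ∷_) (nonzeroVecs k)) (∑-map (true ∷_) (allVecs bits k)))

  -- The binomial theorem in expanded form: each bit independently chooses `x` or `y`.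
  ∑-ones-zeros : ∀ x y k → ∑ (allVecs bits k) (λ s → x ^ ones s * y ^ zeros s) ≈ (x + y) ^ k
  ∑-ones-zeros x y zero    = solve 0 (con 1 :* con 1 :+ con 0 := con 1) ≈-refl
  ∑-ones-zeros x y (suc k) = begin
    ∑ (allVecs bits (suc k)) f
      ≈⟨ ∑-allBits-suc k f ⟩
    ∑ V (λ s → x ^ ones s * (y * y ^ zeros s)) + ∑ V (λ s → x * x ^ ones s * y ^ zeros s)
      ≈⟨ +-cong (≈-trans (∑-cong V λ {s} _ → x∙yz≈y∙xz (x ^ ones s) y (y ^ zeros s)) (*-distribˡ-∑ y g V))
                (≈-trans (∑-cong V λ {s} _ → *-assoc x (x ^ ones s) (y ^ zeros s)) (*-distribˡ-∑ x g V)) ⟩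
    y * ∑ V g + x * ∑ V g
      ≈⟨ +-cong (*-congˡ (∑-ones-zeros x y k)) (*-congˡ (∑-ones-zeros x y k)) ⟩
    y * (x + y) ^ k + x * (x + y) ^ k
      ≈⟨ solve 3 (λ x y p → y :* p :+ x :* p := (x :+ y) :* p) ≈-refl x y ((x + y) ^ k) ⟩
    (x + y) ^ suc k ∎
    where
    V = allVecs bits k
    f : ∀ {k} → Vec Bool k → Carrier
    f s = x ^ ones s * y ^ zeros s
    g : Vec Bool k → Carrier
    g = f

  1^ : ∀ k → 1# ^ k ≈ 1#
  1^ zero    = ≈-refl
  1^ (suc k) = ≈-trans (*-identityˡ _) (1^ k)

  ∑-ones : ∀ x k → ∑ (allVecs bits k) (λ s → x ^ ones s) ≈ (1# + x) ^ k
  ∑-ones x k = ≈-trans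
    (∑-cong (allVecs bits k) λ {s} _ → ≈-sym (≈-trans (*-congˡ (1^ (zeros s))) (*-identityʳ _)))
    (≈-trans (∑-ones-zeros x 1# k) (^-congˡ k (+-comm x 1#)))

  -- Grouped by the position of the first 1, the sum telescopes to `x * (1# + x) ^ k` minus
  -- `x * x ^ k`. Without subtraction in a semiring, the missing term is added on the left; the
  -- south child will supply it.
  ∑-survivors : ∀ x k → ∑ (nonzeroVecs k) (λ s → x ^ survivors s) + x * x ^ k ≈ x * (1# + x) ^ k
  ∑-survivors x zero    = +-identityˡ _
  ∑-survivors x (suc k) = begin
    ∑ (nonzeroVecs (suc k)) (λ s → x ^ survivors s) + x * (x * x ^ k)
      ≈⟨ +-congʳ (≈-trans (∑-nonzero-suc k (λ s → x ^ survivors s))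
           (+-cong (*-distribˡ-∑ x (λ s → x ^ survivors s) (nonzeroVecs k))
                   (≈-trans (*-distribˡ-∑ x (λ s → x ^ ones s) (allVecs bits k)) (*-congˡ (∑-ones x k))))) ⟩
    x * N + x * (1# + x) ^ k + x * (x * x ^ k)
      ≈⟨ solve 4 (λ x N p q → x :* N :+ x :* p :+ x :* q := x :* (N :+ q) :+ x :* p)
           ≈-refl x N ((1# + x) ^ k) (x * x ^ k) ⟩
    x * (N + x * x ^ k) + x * (1# + x) ^ k
      ≈⟨ +-congʳ (*-congˡ (∑-survivors x k)) ⟩
    x * (x * (1# + x) ^ k) + x * (1# + x) ^ k
      ≈⟨ solve 2 (λ x p → x :* (x :* p) :+ x :* p := x :* ((con 1 :+ x) :* p)) ≈-refl x ((1# + x) ^ k) ⟩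
    x * (1# + x) ^ suc k ∎
    where N = ∑ (nonzeroVecs k) (λ s → x ^ survivors s)

  -- The variables are arbitrary elements of the semiring, so the substitutions in the recursion are
  -- mere changes of arguments.
  weight : Carrier → Carrier → Carrier → ∀ {n} → Tableau n → Carrier
  weight x y z T = x ^ (urr T ℕ.∸ 1) * y ^ top₀₁ T * z ^ diag T

  monomial : Carrier → Carrier → Carrier → ℕ → ℕ → ℕ → Carrier
  monomial x y z k t d = x ^ (k ℕ.∸ 1) * y ^ t * z ^ d

  weight-≡ : ∀ x y z {n} (T : Tableau n) {k t d} → urr T ≡ k → top₀₁ T ≡ t → diag T ≡ d →
             weight x y z T ≡ monomial x y z k t d
  weight-≡ x y z T refl refl refl = refl

  module _ (x y z : Carrier) where

    -- Under a diagonal 1 the child's `top₀₁` is independent of the parent's value `t`. This is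
    -- expressed by evaluating the parent's second variable at `1#`, where `1# ^ t` is trivial.
    ∑-westChildren₁ : ∀ k t d →
      ∑ (allVecs bits (suc k)) (λ s → monomial x y z (suc (ones s)) (zeros s) (suc d)) ≈
      z * ((x + y) * monomial (x + y) 1# z (suc k) t d)
    ∑-westChildren₁ k t d = begin
      ∑ (allVecs bits (suc k)) (λ s → x ^ ones s * y ^ zeros s * z ^ suc d)
        ≈⟨ ≈-trans (∑-cong (allVecs bits (suc k)) λ {s} _ → *-comm _ (z ^ suc d))
                 (*-distribˡ-∑ (z ^ suc d) (λ s → x ^ ones s * y ^ zeros s) (allVecs bits (suc k))) ⟩
      z * z ^ d * ∑ (allVecs bits (suc k)) (λ s → x ^ ones s * y ^ zeros s)
        ≈⟨ *-congˡ (∑-ones-zeros x y (suc k)) ⟩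
      z * z ^ d * ((x + y) * (x + y) ^ k)
        ≈⟨ solve 4 (λ z c a p → z :* c :* (a :* p) := z :* (a :* (p :* con 1 :* c)))
             ≈-refl z (z ^ d) (x + y) ((x + y) ^ k) ⟩
      z * ((x + y) * ((x + y) ^ k * 1# * z ^ d))
        ≈⟨ *-congˡ (*-congˡ (*-congʳ (*-congˡ (1^ t)))) ⟨
      z * ((x + y) * ((x + y) ^ k * 1# ^ t * z ^ d)) ∎

    -- Split by the bit of the topmost unrestricted row. A 0 leaves a nonzero vector on the other
    -- `k` rows, and its sum is completed by the south child to `x * (1# + x) ^ k`. A 1 gives the
    -- factor `y` and leaves the others free, which gives `y * (1# + x) ^ k`.
    ∑-southChild-westChildren₀ : ∀ k t d →
      monomial x y z (suc (suc k)) t d +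
      ∑ (nonzeroVecs (suc k)) (λ s → monomial x y z (survivors s) (leading s ℕ.+ t) d) ≈
      (x + y) * monomial (1# + x) y z (suc k) t d
    ∑-southChild-westChildren₀ k t d = begin
      x * x ^ k * y ^ t * z ^ d +
      ∑ (nonzeroVecs (suc k)) (λ s → monomial x y z (survivors s) (leading s ℕ.+ t) d)
        ≈⟨ +-congˡ (∑-nonzero-suc k (λ s → monomial x y z (survivors s) (leading s ℕ.+ t) d)) ⟩
      x * x ^ k * y ^ t * z ^ d + (∑ (nonzeroVecs k) (λ s → x ^ survivors s * y ^ t * z ^ d) +
                                   ∑ (allVecs bits k) (λ s → x ^ ones s * (y * y ^ t) * z ^ d))
        ≈⟨ +-congˡ (+-cong
             (≈-trans (∑-cong (nonzeroVecs k) λ {s} _ →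
               ≈-trans (*-assoc _ _ _) (*-comm _ (y ^ t * z ^ d)))
                    (*-distribˡ-∑ (y ^ t * z ^ d) (λ s → x ^ survivors s) (nonzeroVecs k)))
             (≈-trans (∑-cong (allVecs bits k) λ {s} _ →
               ≈-trans (*-assoc _ _ _) (*-comm _ (y * y ^ t * z ^ d)))
                    (*-distribˡ-∑ (y * y ^ t * z ^ d) (λ s → x ^ ones s) (allVecs bits k)))) ⟩
      x * x ^ k * y ^ t * z ^ d +
      (y ^ t * z ^ d * N + y * y ^ t * z ^ d * ∑ (allVecs bits k) (λ s → x ^ ones s))
        ≈⟨ +-congˡ (+-congˡ (*-congˡ (∑-ones x k))) ⟩
      x * x ^ k * y ^ t * z ^ d + (y ^ t * z ^ d * N + y * y ^ t * z ^ d * (1# + x) ^ k)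
        ≈⟨ solve 6 (λ q b c N y p → q :* b :* c :+ (b :* c :* N :+ y :* b :* c :* p) :=
                                b :* c :* (N :+ q) :+ y :* b :* c :* p)
             ≈-refl (x * x ^ k) (y ^ t) (z ^ d) N y ((1# + x) ^ k) ⟩
      y ^ t * z ^ d * (N + x * x ^ k) + y * y ^ t * z ^ d * (1# + x) ^ k
        ≈⟨ +-congʳ (*-congˡ (∑-survivors x k)) ⟩
      y ^ t * z ^ d * (x * (1# + x) ^ k) + y * y ^ t * z ^ d * (1# + x) ^ k
        ≈⟨ solve 5 (λ x y b c p → b :* c :* (x :* p) :+ y :* b :* c :* p := (x :+ y) :* (p :* b :* c))
             ≈-refl x y (y ^ t) (z ^ d) ((1# + x) ^ k) ⟩
      (x + y) * ((1# + x) ^ k * y ^ t * z ^ d) ∎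
      where N = ∑ (nonzeroVecs k) (λ s → x ^ survivors s)

    ∑-children : ∀ {n} (T : Tableau n) → 1 ℕ.≤ urr T →
      ∑ (children T) (weight x y z) ≈
      (x + y) * weight (1# + x) y z T + z * ((x + y) * weight (x + y) 1# z T)
    ∑-children T 1≤urr = ≈-trans expand (≈-trans
      (+-congˡ (reflexive (cong (λ k → W₁ k + W₀ k) (length-unrestrictedRows T))))
      (collect (urr T) 1≤urr))
      where
      t = top₀₁ T
      d = diag T
      l = length (unrestrictedRows T)
      W₁ W₀ : ℕ → Carrier
      W₁ k = ∑ (allVecs bits k) (λ s → monomial x y z (suc (ones s)) (zeros s) (suc d))
      W₀ k = ∑ (nonzeroVecs k) (λ s → monomial x y z (survivors s) (leading s ℕ.+ t) d)
      expand : ∑ (children T) (weight x y z) ≈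
        monomial x y z (suc (urr T)) t d + (W₁ l + W₀ l)
      expand = +-cong
        (reflexive (weight-≡ x y z (southChild T)
          (SouthStatistics.urr-south T (southChild T) refl) (top₀₁-southChild T 1≤urr)
          (SouthStatistics.diag-south T (southChild T) refl)))
        (≈-trans (∑-++ (weight x y z) (map (westChild T true) (allVecs bits l))) (+-cong
          (≈-trans (∑-map (westChild T true) (allVecs bits l))
            (∑-cong (allVecs bits l) λ {s} _ → reflexive
              (weight-≡ x y z (westChild T true s)
                (urr-westChild₁ T s) (top₀₁-westChild₁ T s) (diag-westChild₁ T s))))
          (≈-trans (∑-map (westChild T false) (nonzeroVecs l))
            (∑-cong (nonzeroVecs l) λ {s} _ → reflexive
              (weight-≡ x y z (westChild T false s)
                (urr-westChild₀ T s) (top₀₁-westChild₀ T 1≤urr s) (diag-westChild₀ T s))))))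
      -- Here `k` stands for `urr T`; being positive, it can be replaced by a successor, which
      -- resolves the `∸ 1` in the exponents.
      collect : ∀ k → 1 ℕ.≤ k → monomial x y z (suc k) t d + (W₁ k + W₀ k) ≈
        (x + y) * monomial (1# + x) y z k t d + z * ((x + y) * monomial (x + y) 1# z k t d)
      collect (suc k) _ = begin
        monomial x y z (suc (suc k)) t d + (W₁ (suc k) + W₀ (suc k))
          ≈⟨ solve 3 (λ a b c → a :+ (b :+ c) := (a :+ c) :+ b)
               ≈-refl (monomial x y z (suc (suc k)) t d) (W₁ (suc k)) (W₀ (suc k)) ⟩
        monomial x y z (suc (suc k)) t d + W₀ (suc k) + W₁ (suc k)
          ≈⟨ +-cong (∑-southChild-westChildren₀ k t d) (∑-westChildren₁ k t d) ⟩
        (x + y) * monomial (1# + x) y z (suc k) t d + z * ((x + y) * monomial (x + y) 1# z (suc k) t d) ∎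

  P : ℕ → Carrier → Carrier → Carrier → Carrier
  P n x y z = ∑ (PTB n) (weight x y z)

  -- The parents have length at least 1, as `∑-children` requires an unrestricted row and the empty
  -- tableau has none.
  P-suc : ∀ n x y z → P (suc (suc n)) x y z ≈
          (x + y) * P (suc n) (1# + x) y z + z * ((x + y) * P (suc n) (x + y) 1# z)
  P-suc n x y z = begin
    ∑ (PTB (suc (suc n))) (weight x y z)
      ≈⟨ ∑-↭ (PTB-suc (suc n)) ⟩
    ∑ (concatMap children (PTB (suc n))) (weight x y z)
      ≈⟨ ∑-concatMap children (PTB (suc n)) ⟩
    ∑ (PTB (suc n)) (λ T → ∑ (children T) (weight x y z))
      ≈⟨ ∑-cong (PTB (suc n)) (λ {T} T∈ → ∑-children x y z T (1≤urr (to (∈-PTB {suc n} {T}) T∈))) ⟩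
    ∑ (PTB (suc n)) (λ T → (x + y) * weight (1# + x) y z T + z * ((x + y) * weight (x + y) 1# z T))
      ≈⟨ ∑-+ (λ T → (x + y) * weight (1# + x) y z T)
             (λ T → z * ((x + y) * weight (x + y) 1# z T)) (PTB (suc n)) ⟩
    ∑ (PTB (suc n)) (λ T → (x + y) * weight (1# + x) y z T) +
    ∑ (PTB (suc n)) (λ T → z * ((x + y) * weight (x + y) 1# z T))
      ≈⟨ +-cong (*-distribˡ-∑ (x + y) (weight (1# + x) y z) (PTB (suc n)))
           (≈-trans (*-distribˡ-∑ z (λ T → (x + y) * weight (x + y) 1# z T) (PTB (suc n)))
             (*-congˡ (*-distribˡ-∑ (x + y) (weight (x + y) 1# z) (PTB (suc n))))) ⟩
    (x + y) * P (suc n) (1# + x) y z + z * ((x + y) * P (suc n) (x + y) 1# z) ∎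

  rising : Carrier → ℕ → Carrier
  rising = risingFactorial rawSemiring

  rising-cong : ∀ {x y} n → x ≈ y → rising x n ≈ rising y n
  rising-cong zero    x≈y = ≈-refl
  rising-cong (suc n) x≈y = *-cong (rising-cong n x≈y) (+-congʳ x≈y)

  -- The definition splits off the last factor; the recursion for `P` produces the first one.
  rising-suc : ∀ x n → rising x (suc n) ≈ x * rising (1# + x) n
  rising-suc x zero    = ≈-trans (*-identityˡ _) (≈-trans (+-identityʳ x) (≈-sym (*-identityʳ x)))
  rising-suc x (suc n) = begin
    rising x (suc n) * (x + (1# + n · 1#))        ≈⟨ *-congʳ (rising-suc x n) ⟩
    x * rising (1# + x) n * (x + (1# + n · 1#))
      ≈⟨ solve 3 (λ x r m → x :* r :* (x :+ (con 1 :+ m)) := x :* (r :* (con 1 :+ x :+ m)))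
           ≈-refl x (rising (1# + x) n) (n · 1#) ⟩
    x * (rising (1# + x) n * (1# + x + n · 1#))   ∎

  -- Both substitutions, `(1# + x , y)` and `(x + y , 1#)`, have the sum `1# + (x + y)`. The
  -- induction hypothesis thus gives the same product twice, with total factor `1# + z`.
  P-formula : ∀ n x y z → P (suc n) x y z ≈ (1# + z) ^ suc n * rising (x + y) n
  P-formula zero    x y z =
    -- There are two tableaux of length 1: a single south step of weight 1, and a single west step
    -- with a diagonal 1, of weight `z`.
    solve 1 (λ z → con 1 :* con 1 :* con 1 :+ (con 1 :* con 1 :* (z :* con 1) :+ con 0) :=
                    (con 1 :+ z) :* con 1 :* con 1) ≈-refl z
  P-formula (suc n) x y z = begin
    P (suc (suc n)) x y z
      ≈⟨ P-suc n x y z ⟩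
    (x + y) * P (suc n) (1# + x) y z + z * ((x + y) * P (suc n) (x + y) 1# z)
      ≈⟨ +-cong (*-congˡ (≈-trans (P-formula n (1# + x) y z) (*-congˡ (rising-cong n (+-assoc 1# x y)))))
           (*-congˡ (*-congˡ (≈-trans (P-formula n (x + y) 1# z)
             (*-congˡ (rising-cong n (+-comm (x + y) 1#)))))) ⟩
    (x + y) * (q * r) + z * ((x + y) * (q * r))
      ≈⟨ solve 4 (λ a q r z → a :* (q :* r) :+ z :* (a :* (q :* r)) := (con 1 :+ z) :* q :* (a :* r))
           ≈-refl (x + y) q r z ⟩
    (1# + z) * q * ((x + y) * r)
      ≈⟨ *-congˡ (rising-suc (x + y) n) ⟨
    (1# + z) ^ suc (suc n) * rising (x + y) (suc n) ∎
    where
    q = (1# + z) ^ suc n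
    r = rising (1# + (x + y)) n

-- Evaluation at the variables of the polynomial ring.

open PolynomialSemiring using (polyCommutativeSemiring)
open import Algebra.Definitions.RawSemiring polyRawSemiring using (_^_)
open RawSemiring polyRawSemiring using (_≈_; _+_; _*_; 1#)

theorem1p4 : (n : ℕ) → 1 ≤ n →
    sumOver polyRawSemiring (PTB n) (λ T → X ^ (urr T ∸ 1) * Y ^ top₀₁ T * Z ^ diag T)
    ≈ (1# + Z) ^ n * risingFactorial polyRawSemiring (X + Y) (n ∸ 1)
theorem1p4 (suc n) _ = GeneratingFunction.P-formula polyCommutativeSemiring n X Y Z
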